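{- Let $n \in \mathbb{N}$ and $f \in \mathbb{N}_0$, and put $N = 2n+f$. Then the set $\mathcal{M}_{N,f}$ is Schur-positive with respect to the statistic $\mathrm{Short}$, and \[ \mathcal{Q}_{N,\mathrm{Short}}(\mathcal{M}_{N,f}) = \sum_{k=0}^{n} \bigl|\{ m \in \mathcal{M}_{N-2k,f} \mid \mathrm{Short}(m) = \emptyset\}\bigr| \, s_{(N-k,k)}. \]
   Context: For $N \ge 1$ and $J \subseteq [N-1]=\{1,\dots,N-1\}$, the fundamental quasisymmetric function is $F_{N,J} = \sum x_{i_1}x_{i_2}\cdots x_{i_N}$, the sum over all $i_1 \le i_2 \le \dots \le i_N$ (positive integers) with $i_j < i_{j+1}$ for every $j \in J$. For a finite set $\mathcal{A}$ and a map $D:\mathcal{A}\to 2^{[N-1]}$, put $\mathcal{Q}_{N,D}(\mathcal{A}) = \sum_{a\in\mathcal{A}} F_{N,D(a)}$. $\mathcal{A}$ is called symmetric with respect to $D$ if $\mathcal{Q}_{N,D}(\mathcal{A})$ is a symmetric function; it then has a unique expansion $\sum_{\lambda\vdash N} c_\lambda s_\lambda$ in Schur functions, and $\mathcal{A}$ is Schur-positive if moreover all $c_\lambda$ are nonnegative integers. A matching on a finite set $S\subseteq\mathbb{N}$ is a partition of $S$ into blocks of size 1 or 2; a block $\{i\}$ is an unmatched vertex, a block $\{i,j\}$ is a chord, written $(i,j)$. $\mathcal{M}_N$ is the set of matchings on $[N]$ and $\mathcal{M}_{N,f}$ the set of those with exactly $f$ unmatched vertices ($\mathcal{M}_{0,0}$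 consists of the empty matching). For $m\in\mathcal{M}_N$, $\mathrm{Short}(m) = \{ i \in [N-1] \mid (i,i+1) \text{ is a chord of } m\}$ (so the pair $(1,N)$ is never counted). -}

module Defs where

open import Data.Nat.Base using (ℕ; zero; suc; _+_; _*_; _∸_; _≡ᵇ_; _<ᵇ_; _≤ᵇ_; _⊓_)
open import Data.Bool.Base using (Bool; true; false; _∧_)
open import Data.List.Base using (List; []; _∷_; [_]; map; concat; concatMap; filterᵇ; length; upTo)
open import Data.Nat.ListAction using (sum)
open import Data.Bool.ListAction using (all)
open import Data.Product.Base using (Σ; _×_)
open import Relation.Binary.PropositionalEquality using (_≡_)

range1 : ℕ → List ℕ
range1 k = map suc (upTo k)

allLists : ℕ → List ℕ → List (List ℕ)
allLists zero    vs = [ [] ]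
allLists (suc r) vs = concatMap (λ v → map (v ∷_) (allLists r vs)) vs

-- 1-based entry of a list (0 if out of range)
entry : List ℕ → ℕ → ℕ
entry []       _             = 0
entry (x ∷ xs) zero          = 0
entry (x ∷ xs) (suc zero)    = x
entry (x ∷ xs) (suc (suc i)) = entry xs (suc i)

nondec : List ℕ → Bool
nondec (x ∷ y ∷ xs) = (x ≤ᵇ y) ∧ nondec (y ∷ xs)
nondec _            = true

occ : ℕ → List ℕ → ℕ
occ v xs = length (filterᵇ (λ x → x ≡ᵇ v) xs)

-- xs (with entries in [1..length α]) has content α, i.e. the value p
-- occurs exactly α_p times
hasContent : List ℕ → List ℕ → Bool
hasContent α xs = all (λ p → occ p xs ≡ᵇ entry α p) (range1 (length α))

-- Formal power series in x₁, x₂, … with ℕ coefficients, given by their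
-- coefficient function on monomials.  A monomial x₁^α₁ ⋯ x_ℓ^α_ℓ is
-- given by its exponent list α = α₁ ∷ … ∷ α_ℓ ∷ [] (trailing zeros allowed).

Series : Set
Series = List ℕ → ℕ

_≈_ : Series → Series → Set
A ≈ B = ∀ α → A α ≡ B α

infix 4 _≈_

-- Fundamental quasisymmetric function F_{N,J}; J ⊆ [N-1] given as a list
-- of its elements.  Coefficient of x^α = number of sequences
-- i₁ ≤ … ≤ i_N with i_j < i_{j+1} for j ∈ J and i₁⋯i_N-monomial = x^α
-- (only variables x₁..x_ℓ, ℓ = length α, can occur).
F : ℕ → List ℕ → Series
F N J α = length (filterᵇ ok (allLists N (range1 (length α))))
  where
  ok : List ℕ → Bool
  ok is = nondec is ∧ (all (λ j → entry is j <ᵇ entry is (suc j)) J ∧ hasContent α is)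

-- Q_{N,D}(A) = Σ_{a ∈ A} F_{N,D(a)}   (A a finite set given as a duplicate-free list)
Q : {X : Set} → ℕ → (X → List ℕ) → List X → Series
Q N D A α = sum (map (λ a → F N (D a) α) A)

-- Schur functions s_λ, λ = list of row lengths (weakly decreasing).
-- Coefficient of x^α = number of semistandard Young tableaux of shape λ
-- (rows weakly increasing, columns strictly increasing) with content α.

rowFillings : List ℕ → List ℕ → List (List (List ℕ))
rowFillings []      vs = [ [] ]
rowFillings (r ∷ λs) vs =
  concatMap (λ row → map (row ∷_) (rowFillings λs vs)) (filterᵇ nondec (allLists r vs))

colStrict : List (List ℕ) → Bool
colStrict (R₁ ∷ R₂ ∷ Rs) =
  all (λ j → entry R₁ j <ᵇ entry R₂ j) (range1 (length R₂)) ∧ colStrict (R₂ ∷ Rs)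
colStrict _ = true

schur : List ℕ → Series
schur λs α =
  length (filterᵇ (λ T → colStrict T ∧ hasContent α (concat T))
                  (rowFillings λs (range1 (length α))))

-- partitions of n with all parts ≤ m (weakly decreasing lists of positive
-- integers); first argument is fuel (≥ n suffices)
partitionsF : ℕ → ℕ → ℕ → List (List ℕ)
partitionsF _        zero    _ = [ [] ]
partitionsF zero     (suc n) _ = []
partitionsF (suc fu) (suc n) m =
  concatMap (λ k → map (k ∷_) (partitionsF fu (suc n ∸ k) k)) (range1 (m ⊓ suc n))

partitions : ℕ → List (List ℕ)
partitions N = partitionsF N N N

-- Schur-positivity of a series homogeneous of degree N:
-- it equals Σ_{λ ⊢ N} c_λ s_λ with all c_λ ∈ ℕ.  (Such an expansion
-- forces symmetry; uniqueness of c is a standard fact.)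
SchurPositive : ℕ → Series → Set
SchurPositive N G =
  Σ (List ℕ → ℕ) λ c → G ≈ (λ α → sum (map (λ μ → c μ * schur μ α) (partitions N)))

-- Matchings on [N], encoded as involutions p of [N] (written as the list
-- p(1) ∷ … ∷ p(N)): a chord (i,j) ↔ p i = j, p j = i; unmatched i ↔ p i = i.

isInvolution : List ℕ → Bool
isInvolution p = all (λ i → entry p (entry p i) ≡ᵇ i) (range1 (length p))

matchings : ℕ → List (List ℕ)
matchings N = filterᵇ isInvolution (allLists N (range1 N))

unmatched : List ℕ → ℕ
unmatched p = length (filterᵇ (λ i → entry p i ≡ᵇ i) (range1 (length p)))

matchingsF : ℕ → ℕ → List (List ℕ)
matchingsF N f = filterᵇ (λ p → unmatched p ≡ᵇ f) (matchings N)

Short : List ℕ → List ℕ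
Short p = filterᵇ (λ i → entry p i ≡ᵇ suc i) (range1 (length p ∸ 1))

isEmptyShort : List ℕ → Bool
isEmptyShort p with Short p
... | []    = true
... | _ ∷ _ = false

noShortCount : ℕ → ℕ → ℕ
noShortCount M f = length (filterᵇ isEmptyShort (matchingsF M f))

rhs : ℕ → ℕ → Series
rhs n f α =
  sum (map (λ k → noShortCount (2 * n + f ∸ 2 * k) f * schur (2 * n + f ∸ k ∷ k ∷ []) α)
           (upTo (suc n)))

{-# OPTIONS --safe #-}

-- The coefficient of x^α in F_{N,J} is 1 if α sums to N and J consists of
-- partial sums of α, and 0 otherwise.  Hence the coefficient of x^α on the left
-- counts the matchings of a row of N points, cut into consecutive blocks of
-- sizes α₁, α₂, …, in which no short chord lies inside a block.  Both sides, as
-- functions of N and α, satisfy the recursion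
--
--   G_N(a, b, γ) = G_N(a + b, γ) + G_{N-2}(a - 1, b - 1, γ)     (a, b ≥ 1).
--
-- For matchings, the last term counts those with a short chord across the first
-- cut: delete that chord.  For tableaux of shape (N - k, k), the first term counts
-- those without a 2 in the second row (identify the letters 1 and 2), and the
-- last one those whose first column is (1, 2) (delete that column).  Zero blocks
-- may be dropped, and for a single block only the term k = 0 survives, where both
-- sides count the matchings without short chords.
module Submission where

open import Defs
open import Data.Bool.Base using (Bool; T; _∧_; false; if_then_else_; true)
open import Data.Bool.ListAction using (all)
open import Data.Bool.Properties using (T-∧; T-≡; T?)
open import Data.Empty using (⊥; ⊥-elim)
open import Data.List.Base
  using (List; []; _++_; _∷_; applyUpTo; concat; concatMap; filterᵇ; length; map; replicate; upTo)
import Data.List.Membership.DecPropositional as DecMembership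
open import Data.List.Membership.Propositional using (_∈_)
open import Data.List.Membership.Propositional.Properties
  using (∈-++⁺ʳ; ∈-++⁺ˡ; ∈-++⁻; ∈-filter⁺; ∈-filter⁻; ∈-insert; ∈-map⁺; ∈-map⁻; ∈-upTo⁺; ∈-upTo⁻; ∈-∃++)
open import Data.List.Properties
  using (++-assoc; ++-identityʳ; filter-++; length-++; length-filter; length-map; length-replicate;
         length-upTo; map-++; map-applyUpTo; map-cong-local; map-upTo; map-∘; ∷-injectiveʳ;
         ∷-injectiveˡ; ≡-dec)
open import Data.List.Relation.Binary.Permutation.Propositional using (↭-sym; ↭⇒↭ₛ)
open import Data.List.Relation.Binary.Permutation.Propositional.Properties as Perm
  using (shift; ∈-resp-↭)
import Data.List.Relation.Binary.Permutation.Setoid.Properties as PermSetoid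
open import Data.List.Relation.Binary.Pointwise using (Pointwise; []; _∷_)
open import Data.List.Relation.Unary.All as All using (All; []; _∷_)
import Data.List.Relation.Unary.All.Properties as All
open import Data.List.Relation.Unary.AllPairs as AllPairs using (AllPairs; []; _∷_)
import Data.List.Relation.Unary.AllPairs.Properties as AllPairs
open import Data.List.Relation.Unary.Any using (here; there)
open import Data.List.Relation.Unary.Unique.Propositional using (Unique)
import Data.List.Relation.Unary.Unique.Propositional.Properties as Unique
open import Data.Nat.Base
open import Data.Nat.ListAction using (sum)
open import Data.Nat.ListAction.Properties using (sum-↭)
open import Data.Nat.Properties
open import Data.Product.Base using (_,_; _×_; proj₁; proj₂; ∃)
open import Data.Sum.Base using ([_,_]′; _⊎_; inj₁; inj₂)
open import Data.Unit.Base using (tt)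
open import Function.Base using (_∘_; flip; id)
open import Function.Bundles using (Equivalence)
open import Relation.Binary.PropositionalEquality
open import Relation.Nullary using (contradiction; does; no; yes; ¬_)
open import Relation.Nullary.Decidable using (dec-false; dec-true)

-- Deleting the chord across the first cut can create a new short chord, joining the two points that
-- become neighbours there. That chord again lies across the first cut, now between blocks of sizes
-- a - 1 and b - 1, where short chords are allowed. So the deletion is a bijection without side
-- conditions. For the Schur side, the multiplicity of s_(N-k,k) depends on N and k only through N -
-- 2k, and removing a column lowers N by 2 and k by 1. Hence the two recursions agree term by term
-- with the same multiplicities. Merging lowers the number of blocks and the last term lowers n; at
-- n = 0 that last term is absent on both sides, because no chord and no second row is left. Thus
-- the single-block values determine everything.

-- Counting by bijections between duplicate-free lists

record Enumerates {A : Set} (P : A → Set) (xs : List A) : Set where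
  field
    unique   : Unique xs
    sound    : ∀ {x} → x ∈ xs → P x
    complete : ∀ {x} → P x → x ∈ xs

open Enumerates

module _ {A B : Set} (R : A → B → Set) where

  -- Pigeonhole: the partner `y` of the head is cut out of `ys`. A later element with the same
  -- partner would equal the head by injectivity, against uniqueness, so the remaining elements find
  -- their partners in what is left.
  length-≤ : ∀ {xs ys} → Unique xs →
             (∀ {x} → x ∈ xs → ∃ λ y → y ∈ ys × R x y) →
             (∀ {x x′ y} → x ∈ xs → x′ ∈ xs → y ∈ ys → R x y → R x′ y → x ≡ x′) →
             length xs ≤ length ys
  length-≤ {[]}     _          _     _   = z≤n
  length-≤ {x ∷ xs} (x∉xs ∷ u) total inj
    with y , y∈ys , Rxy ← total (here refl)
    with as , bs , refl ← ∈-∃++ y∈ys = begin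
      suc (length xs)               ≤⟨ s≤s (length-≤ u total′ inj′) ⟩
      suc (length (as ++ bs))       ≡⟨ cong suc (length-++ as) ⟩
      suc (length as + length bs)   ≡⟨ +-suc (length as) (length bs) ⟨
      length as + suc (length bs)   ≡⟨ length-++ as ⟨
      length (as ++ y ∷ bs)         ∎
    where
    open ≤-Reasoning
    weaken : ∀ {z} → z ∈ as ++ bs → z ∈ as ++ y ∷ bs
    weaken z∈ with ∈-++⁻ as z∈
    ... | inj₁ z∈as = ∈-++⁺ˡ z∈as
    ... | inj₂ z∈bs = ∈-++⁺ʳ as (there z∈bs)
    total′ : ∀ {x′} → x′ ∈ xs → ∃ λ y′ → y′ ∈ as ++ bs × R x′ y′
    total′ x′∈ with y′ , y′∈ , Rx′y′ ← total (there x′∈) with ∈-++⁻ as y′∈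
    ... | inj₁ y′∈as         = y′ , ∈-++⁺ˡ y′∈as , Rx′y′
    ... | inj₂ (there y′∈bs) = y′ , ∈-++⁺ʳ as y′∈bs , Rx′y′
    ... | inj₂ (here refl)   =
      contradiction (inj (here refl) (there x′∈) (∈-insert as) Rxy Rx′y′) (All.lookup x∉xs x′∈)
    inj′ : ∀ {x₁ x₂ y′} → x₁ ∈ xs → x₂ ∈ xs → y′ ∈ as ++ bs → R x₁ y′ → R x₂ y′ → x₁ ≡ x₂
    inj′ x₁∈ x₂∈ y′∈ = inj (there x₁∈) (there x₂∈) (weaken y′∈)

-- A bijection between the enumerated sets, given by its graph R.
length-≡ : {A B : Set} {P : A → Set} {P′ : B → Set} (R : A → B → Set) {xs : List A} {ys : List B} →
           Enumerates P xs → Enumerates P′ ys →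
           (∀ {x} → P x → ∃ λ y → P′ y × R x y) →
           (∀ {y} → P′ y → ∃ λ x → P x × R x y) →
           (∀ {x x′ y} → P x → P x′ → P′ y → R x y → R x′ y → x ≡ x′) →
           (∀ {x y y′} → P x → P′ y → P′ y′ → R x y → R x y′ → y ≡ y′) →
           length xs ≡ length ys
length-≡ R ex ey total surj inj fun = ≤-antisym
  (length-≤ R (unique ex)
    (λ x∈ → let y , py , r = total (sound ex x∈) in y , complete ey py , r)
    (λ x∈ x′∈ y∈ → inj (sound ex x∈) (sound ex x′∈) (sound ey y∈)))
  (length-≤ (flip R) (unique ey)
    (λ y∈ → let x , px , r = surj (sound ey y∈) in x , complete ex px , r)
    (λ y∈ y′∈ x∈ → fun (sound ex x∈) (sound ey y∈) (sound ey y′∈)))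

enum-length : {A : Set} {P P′ : A → Set} {xs ys : List A} →
              Enumerates P xs → Enumerates P′ ys →
              (∀ {x} → P x → P′ x) → (∀ {x} → P′ x → P x) → length xs ≡ length ys
enum-length ex ey to from = length-≡ _≡_ ex ey (λ p → _ , to p , refl) (λ p → _ , from p , refl)
  (λ _ _ _ p q → trans p (sym q)) (λ _ _ _ p q → trans (sym p) q)

enum-resp : {A : Set} {P P′ : A → Set} {xs : List A} → Enumerates P xs →
            (∀ {x} → P x → P′ x) → (∀ {x} → P′ x → P x) → Enumerates P′ xs
enum-resp e to from = record
  { unique = unique e ; sound = to ∘ sound e ; complete = complete e ∘ from }

enum-filterᵇ : {A : Set} {P : A → Set} {xs : List A} (p : A → Bool) → Enumerates P xs →
               Enumerates (λ x → P x × T (p x)) (filterᵇ p xs)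
enum-filterᵇ p e = record
  { unique   = Unique.filter⁺ (T? ∘ p) (unique e)
  ; sound    = λ x∈ → let x∈xs , px = ∈-filter⁻ (T? ∘ p) x∈ in sound e x∈xs , px
  ; complete = λ (Px , px) → ∈-filter⁺ (T? ∘ p) (complete e Px) px }

enum-[] : {A : Set} {P : A → Set} → (∀ {x} → ¬ P x) → Enumerates P []
enum-[] ¬P = record { unique = [] ; sound = λ () ; complete = λ p → ⊥-elim (¬P p) }

enum-[_] : {A : Set} (x : A) → Enumerates (_≡ x) (x ∷ [])
enum-[ x ] = record
  { unique = [] ∷ [] ; sound = λ { (here eq) → eq } ; complete = λ eq → here eq }

-- The right-hand sides of the recursions are sums of two counts; tagging turns such a sum into the
-- length of one enumeration, to which `length-≡` applies.
data _⊎ᵖ_ {A B : Set} (P : A → Set) (P′ : B → Set) : A ⊎ B → Set where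
  inˡ : ∀ {x} → P x → (P ⊎ᵖ P′) (inj₁ x)
  inʳ : ∀ {y} → P′ y → (P ⊎ᵖ P′) (inj₂ y)

enum-⊎ : {A B : Set} {P : A → Set} {P′ : B → Set} {xs : List A} {ys : List B} →
         Enumerates P xs → Enumerates P′ ys →
         Enumerates (P ⊎ᵖ P′) (map inj₁ xs ++ map inj₂ ys)
enum-⊎ {P = P} {P′} {xs} {ys} ex ey = record
  { unique   = Unique.++⁺ (Unique.map⁺ (λ { refl → refl }) (unique ex))
                          (Unique.map⁺ (λ { refl → refl }) (unique ey)) disjoint
  ; sound    = λ z∈ → [ soundˡ , soundʳ ]′ (∈-++⁻ (map inj₁ xs) z∈)
  ; complete = λ { (inˡ p) → ∈-++⁺ˡ (∈-map⁺ inj₁ (complete ex p))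
                 ; (inʳ p) → ∈-++⁺ʳ (map inj₁ xs) (∈-map⁺ inj₂ (complete ey p)) } }
  where
  disjoint : ∀ {z} → z ∈ map inj₁ xs × z ∈ map inj₂ ys → ⊥
  disjoint (z∈₁ , z∈₂) with _ , _ , refl ← ∈-map⁻ inj₁ z∈₁ | _ , _ , () ← ∈-map⁻ inj₂ z∈₂
  soundˡ : ∀ {z} → z ∈ map inj₁ xs → (P ⊎ᵖ P′) z
  soundˡ z∈ with _ , x∈ , refl ← ∈-map⁻ inj₁ z∈ = inˡ (sound ex x∈)
  soundʳ : ∀ {z} → z ∈ map inj₂ ys → (P ⊎ᵖ P′) z
  soundʳ z∈ with _ , y∈ , refl ← ∈-map⁻ inj₂ z∈ = inʳ (sound ey y∈)

length-⊎ : {A B : Set} (xs : List A) (ys : List B) →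
           length (map {B = A ⊎ B} inj₁ xs ++ map inj₂ ys) ≡ length xs + length ys
length-⊎ xs ys = trans (length-++ (map inj₁ xs)) (cong₂ _+_ (length-map inj₁ xs) (length-map inj₂ ys))

module _ {A : Set} (G : A → List (List A)) where

  -- `allLists`, `rowFillings` and `partitionsF` are all concatenations of this shape; only in the
  -- last does the list of tails depend on the head.
  prepend : A → List (List A)
  prepend x = map (x ∷_) (G x)

  ∈-prepend⁻ : ∀ as {zs} → zs ∈ concatMap prepend as →
               ∃ λ x → ∃ λ xs → zs ≡ x ∷ xs × x ∈ as × xs ∈ G x
  ∈-prepend⁻ (a ∷ as) zs∈ with ∈-++⁻ (prepend a) zs∈
  ... | inj₁ zs∈a with xs , xs∈ , refl ← ∈-map⁻ (a ∷_) zs∈a = a , xs , refl , here refl , xs∈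
  ... | inj₂ zs∈as with x , xs , eq , x∈ , xs∈ ← ∈-prepend⁻ as zs∈as = x , xs , eq , there x∈ , xs∈

  ∈-prepend⁺ : ∀ {as x xs} → x ∈ as → xs ∈ G x → (x ∷ xs) ∈ concatMap prepend as
  ∈-prepend⁺ (here refl) xs∈ = ∈-++⁺ˡ (∈-map⁺ _ xs∈)
  ∈-prepend⁺ {a ∷ _} (there x∈) xs∈ = ∈-++⁺ʳ (prepend a) (∈-prepend⁺ x∈ xs∈)

  unique-prepend : ∀ {as} → Unique as → (∀ x → Unique (G x)) → Unique (concatMap prepend as)
  unique-prepend []        uG = []
  unique-prepend {a ∷ as} (a∉as ∷ u) uG =
    Unique.++⁺ (Unique.map⁺ (λ { refl → refl }) (uG a)) (unique-prepend u uG) disjoint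
    where
    disjoint : ∀ {z} → z ∈ prepend a × z ∈ concatMap prepend as → ⊥
    disjoint (z∈₁ , z∈₂) with _ , _ , refl ← ∈-map⁻ (a ∷_) z∈₁
      with _ , _ , refl , a∈as , _ ← ∈-prepend⁻ as z∈₂ = All.lookup a∉as a∈as refl

enum-allLists : ∀ r {vs} → Unique vs → Enumerates (λ xs → length xs ≡ r × All (_∈ vs) xs) (allLists r vs)
enum-allLists zero u = record
  { unique = [] ∷ [] ; sound = λ { (here refl) → refl , [] } ; complete = λ { {[]} _ → here refl } }
enum-allLists (suc r) {vs} u = record
  { unique   = unique-prepend (λ _ → allLists r vs) u (λ _ → unique IH)
  ; sound    = snd
  ; complete = λ { {[]} () ; {x ∷ xs} (eq , v ∷ a) →
                   ∈-prepend⁺ (λ _ → allLists r vs) v (complete IH (suc-injective eq , a)) } }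
  where
  IH = enum-allLists r u
  snd : ∀ {xs} → xs ∈ allLists (suc r) vs → length xs ≡ suc r × All (_∈ vs) xs
  snd xs∈ with x , ys , refl , x∈ , ys∈ ← ∈-prepend⁻ (λ _ → allLists r vs) vs xs∈ =
    let l , a = sound IH ys∈ in cong suc l , x∈ ∷ a

InR : ℕ → ℕ → Set
InR n i = 1 ≤ i × i ≤ n

∈-range1⁻ : ∀ {n i} → i ∈ range1 n → InR n i
∈-range1⁻ i∈ with j , j∈ , refl ← ∈-map⁻ suc i∈ = s≤s z≤n , ∈-upTo⁻ j∈

∈-range1⁺ : ∀ {n i} → InR n i → i ∈ range1 n
∈-range1⁺ {i = suc i} (_ , i<n) = ∈-map⁺ suc (∈-upTo⁺ i<n)

unique-range1 : ∀ n → Unique (range1 n)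
unique-range1 n = Unique.map⁺ suc-injective (Unique.upTo⁺ n)

all-range1⁻ : ∀ {n} (p : ℕ → Bool) → T (all p (range1 n)) → ∀ {i} → InR n i → T (p i)
all-range1⁻ {n} p t i∈ = All.lookup (All.all⁺ p (range1 n) t) (∈-range1⁺ i∈)

all-range1⁺ : ∀ {n} (p : ℕ → Bool) → (∀ {i} → InR n i → T (p i)) → T (all p (range1 n))
all-range1⁺ {n} p h = All.all⁻ p (All.tabulate (λ i∈ → h (∈-range1⁻ i∈)))

∧⁻ : ∀ {x y} → T (x ∧ y) → T x × T y
∧⁻ = Equivalence.to T-∧

∧⁺ : ∀ {x y} → T x → T y → T (x ∧ y)
∧⁺ p q = Equivalence.from T-∧ (p , q)

-- Sequences and fundamental quasisymmetric functions

Sorted : List ℕ → Set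
Sorted = AllPairs _≤_

sorted-∷ : ∀ {x y xs} → x ≤ y → Sorted (y ∷ xs) → Sorted (x ∷ y ∷ xs)
sorted-∷ x≤y (y≤ ∷ s) = (x≤y ∷ All.map (≤-trans x≤y) y≤) ∷ y≤ ∷ s

nondec⁻ : ∀ xs → T (nondec xs) → Sorted xs
nondec⁻ []           _ = []
nondec⁻ (x ∷ [])     _ = [] ∷ []
nondec⁻ (x ∷ y ∷ xs) t =
  sorted-∷ (≤ᵇ⇒≤ x y (proj₁ (∧⁻ {x ≤ᵇ y} t))) (nondec⁻ (y ∷ xs) (proj₂ (∧⁻ {x ≤ᵇ y} t)))

nondec⁺ : ∀ {xs} → Sorted xs → T (nondec xs)
nondec⁺ []                            = tt
nondec⁺ ([] ∷ [])                     = tt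
nondec⁺ ((x≤y ∷ _) ∷ s@(_ ∷ _)) = ∧⁺ (≤⇒≤ᵇ x≤y) (nondec⁺ s)

≡ᵇ-refl : ∀ n → (n ≡ᵇ n) ≡ true
≡ᵇ-refl zero    = refl
≡ᵇ-refl (suc n) = ≡ᵇ-refl n

≢⇒≡ᵇ : ∀ {m n} → m ≢ n → (m ≡ᵇ n) ≡ false
≢⇒≡ᵇ {m} {n} m≢n with m ≡ᵇ n | ≡ᵇ⇒≡ m n
... | false | _ = refl
... | true  | f = contradiction (f tt) m≢n

occ-here : ∀ v xs → occ v (v ∷ xs) ≡ suc (occ v xs)
occ-here v xs rewrite ≡ᵇ-refl v = refl

occ-there : ∀ {v x} xs → x ≢ v → occ v (x ∷ xs) ≡ occ v xs
occ-there xs x≢v rewrite ≢⇒≡ᵇ x≢v = refl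

occ-++ : ∀ v xs ys → occ v (xs ++ ys) ≡ occ v xs + occ v ys
occ-++ v xs ys = trans (cong length (filter-++ (λ x → T? (x ≡ᵇ v)) xs ys)) (length-++ (filterᵇ (_≡ᵇ v) xs))

occ-none : ∀ {v xs} → All (_≢ v) xs → occ v xs ≡ 0
occ-none []                 = refl
occ-none {v} {_ ∷ xs} (n ∷ ns) = trans (occ-there xs n) (occ-none ns)

occ-∈ : ∀ {v xs} → v ∈ xs → occ v xs ≢ 0
occ-∈ {v} {_ ∷ xs} (here refl) eq with () ← trans (sym (occ-here v xs)) eq
occ-∈ {v} {x ∷ xs} (there v∈) eq with x ≟ v
... | yes refl with () ← trans (sym (occ-here v xs)) eq
... | no  x≢v  = occ-∈ v∈ (trans (sym (occ-there xs x≢v)) eq)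

∈-occ : ∀ {v} xs → occ v xs ≢ 0 → v ∈ xs
∈-occ []       h = contradiction refl h
∈-occ {v} (x ∷ xs) h with x ≟ v
... | yes refl = here refl
... | no  x≢v  = there (∈-occ xs (h ∘ trans (occ-there xs x≢v)))

occ-tail : ∀ {v} x xs ys → occ v (x ∷ xs) ≡ occ v (x ∷ ys) → occ v xs ≡ occ v ys
occ-tail {v} x xs ys eq with x ≟ v
... | yes refl = suc-injective (trans (sym (occ-here v xs)) (trans eq (occ-here v ys)))
... | no  x≢v  = trans (sym (occ-there xs x≢v)) (trans eq (occ-there ys x≢v))

sorted-head : ∀ {v y ys} → Sorted (y ∷ ys) → v ∈ y ∷ ys → y ≤ v
sorted-head _        (here refl) = ≤-refl
sorted-head (y≤ ∷ _) (there v∈)  = All.lookup y≤ v∈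

-- Each head occurs in the other list and is a minimum of its own, so the heads coincide and can be
-- removed.
sorted-unique : ∀ {xs ys} → Sorted xs → Sorted ys → (∀ v → occ v xs ≡ occ v ys) → xs ≡ ys
sorted-unique {[]}     {[]}     _  _  _  = refl
sorted-unique {[]}     {y ∷ ys} _  _  eq = contradiction (sym (eq y)) (occ-∈ {xs = y ∷ ys} (here refl))
sorted-unique {x ∷ xs} {[]}     _  _  eq = contradiction (eq x) (occ-∈ {xs = x ∷ xs} (here refl))
sorted-unique {x ∷ xs} {y ∷ ys} sx@(_ ∷ sx′) sy@(_ ∷ sy′) eq
  with refl ← ≤-antisym
    (sorted-head sx (∈-occ (x ∷ xs) (occ-∈ {xs = y ∷ ys} (here refl) ∘ trans (sym (eq y)))))
    (sorted-head sy (∈-occ (y ∷ ys) (occ-∈ {xs = x ∷ xs} (here refl) ∘ trans (eq x)))) =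
  cong (x ∷_) (sorted-unique sx′ sy′ λ v → occ-tail x xs ys (eq v))

entry-0 : ∀ xs → entry xs 0 ≡ 0
entry-0 []       = refl
entry-0 (x ∷ xs) = refl

entry-> : ∀ xs {i} → length xs < i → entry xs i ≡ 0
entry-> []       _ = refl
entry-> (x ∷ xs) {suc (suc i)} (s≤s l) = entry-> xs l

-- With entry α p = 0 for p outside [1..length α], this condition for all p also
-- bounds the entries of xs.
Content : List ℕ → List ℕ → Set
Content α xs = ∀ p → occ p xs ≡ entry α p

content⁻ : ∀ α {xs} → All (_∈ range1 (length α)) xs → T (hasContent α xs) → Content α xs
content⁻ α {xs} a t p with 1 ≤? p | p ≤? length α
... | yes 1≤p | yes p≤ = ≡ᵇ⇒≡ _ _ (all-range1⁻ {length α} _ t (1≤p , p≤))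
... | no  1≰p | _ with refl ← n≤0⇒n≡0 (s≤s⁻¹ (≰⇒> 1≰p)) =
  trans (occ-none (All.map (λ { x∈ refl → 1≰p (proj₁ (∈-range1⁻ x∈)) }) a)) (sym (entry-0 α))
... | yes _   | no p≰ =
  trans (occ-none (All.map (λ { x∈ refl → p≰ (proj₂ (∈-range1⁻ x∈)) }) a)) (sym (entry-> α (≰⇒> p≰)))

content⁺ : ∀ α {xs} → Content α xs → All (_∈ range1 (length α)) xs × T (hasContent α xs)
content⁺ α {xs} c = All.tabulate inRange , all-range1⁺ {length α} _ (λ {i} _ → ≡⇒≡ᵇ _ _ (c i))
  where
  inRange : ∀ {x} → x ∈ xs → x ∈ range1 (length α)
  inRange {zero}  x∈ = contradiction (trans (c 0) (entry-0 α)) (occ-∈ x∈)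
  inRange {suc x} x∈ with suc x ≤? length α
  ... | yes x≤ = ∈-range1⁺ (s≤s z≤n , x≤)
  ... | no  x≰ = contradiction (trans (c (suc x)) (entry-> α (≰⇒> x≰))) (occ-∈ x∈)

-- For `v = 1` this is the only weakly increasing sequence of content `α`, hence the only candidate
-- for the monomial in a fundamental quasisymmetric function.
canon : ℕ → List ℕ → List ℕ
canon v []      = []
canon v (a ∷ α) = replicate a v ++ canon (suc v) α

canon-≥ : ∀ v α → All (v ≤_) (canon v α)
canon-≥ v []      = []
canon-≥ v (a ∷ α) = All.++⁺ (All.replicate⁺ a ≤-refl) (All.map <⇒≤ (canon-≥ (suc v) α))

sorted-replicate-++ : ∀ a {v xs} → All (v ≤_) xs → Sorted xs → Sorted (replicate a v ++ xs)
sorted-replicate-++ zero    h s = s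
sorted-replicate-++ (suc a) h s = All.++⁺ (All.replicate⁺ a ≤-refl) h ∷ sorted-replicate-++ a h s

sorted-canon : ∀ v α → Sorted (canon v α)
sorted-canon v []      = []
sorted-canon v (a ∷ α) =
  sorted-replicate-++ a (All.map <⇒≤ (canon-≥ (suc v) α)) (sorted-canon (suc v) α)

occ-replicate : ∀ a v → occ v (replicate a v) ≡ a
occ-replicate zero    v = refl
occ-replicate (suc a) v = trans (occ-here v (replicate a v)) (cong suc (occ-replicate a v))

occ-replicate-≢ : ∀ a {v w} → w ≢ v → occ v (replicate a w) ≡ 0
occ-replicate-≢ a w≢v = occ-none (All.replicate⁺ a w≢v)

occ-canon : ∀ v α i → occ (v + i) (canon v α) ≡ entry α (suc i)
occ-canon v []      i = refl
occ-canon v (a ∷ α) zero rewrite +-identityʳ v =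
  trans (occ-++ v (replicate a v) _)
    (trans (cong₂ _+_ (occ-replicate a v)
                      (occ-none (All.map (λ { v< refl → <-irrefl refl v< }) (canon-≥ (suc v) α))))
           (+-identityʳ a))
occ-canon v (a ∷ α) (suc i) =
  trans (occ-++ (v + suc i) (replicate a v) _)
    (cong₂ _+_ (occ-replicate-≢ a (λ eq → m≢1+m+n v (trans eq (+-suc v i))))
               (trans (cong (λ w → occ w (canon (suc v) α)) (+-suc v i)) (occ-canon (suc v) α i)))

content-canon : ∀ α → Content α (canon 1 α)
content-canon α zero    =
  trans (occ-none (All.map (λ { () refl }) (canon-≥ 1 α))) (sym (entry-0 α))
content-canon α (suc p) = occ-canon 1 α p

canon-unique : ∀ α {is} → Sorted is → Content α is → is ≡ canon 1 α
canon-unique α s c =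
  sorted-unique s (sorted-canon 1 α) λ v → trans (c v) (sym (content-canon α v))

length-replicate-++ : ∀ a {v : ℕ} xs → length (replicate a v ++ xs) ≡ a + length xs
length-replicate-++ zero    xs = refl
length-replicate-++ (suc a) xs = cong suc (length-replicate-++ a xs)

length-canon : ∀ v α → length (canon v α) ≡ sum α
length-canon v []      = refl
length-canon v (a ∷ α) = trans (length-replicate-++ a _) (cong (a +_) (length-canon (suc v) α))

-- bnd α j: some nonempty initial segment of α has sum j.
bnd : List ℕ → ℕ → Bool
bnd []          _       = false
bnd (zero ∷ α)  zero    = true
bnd (zero ∷ α)  (suc j) = bnd α (suc j)
bnd (suc a ∷ α) zero    = false
bnd (suc a ∷ α) (suc j) = bnd (a ∷ α) j

entry-canon-1 : ∀ v α → 1 ≤ sum α → v ≤ entry (canon v α) 1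
entry-canon-1 v (zero ∷ α)  h = <⇒≤ (entry-canon-1 (suc v) α h)
entry-canon-1 v (suc a ∷ α) h = ≤-refl

<ᵇ-true : ∀ {m n} → m < n → (m <ᵇ n) ≡ true
<ᵇ-true m<n = Equivalence.to T-≡ (<⇒<ᵇ m<n)

<ᵇ-irrefl : ∀ n → (n <ᵇ n) ≡ false
<ᵇ-irrefl zero    = refl
<ᵇ-irrefl (suc n) = <ᵇ-irrefl n

-- The letter changes only where a block ends. The bound keeps the second position inside the word:
-- at its very end `bnd` is true, but the default entry 0 would give no ascent.
canon-ascent : ∀ v α j → 2 + j ≤ sum α →
               (entry (canon v α) (suc j) <ᵇ entry (canon v α) (2 + j)) ≡ bnd α (suc j)
canon-ascent v (zero ∷ α)        j       h       = canon-ascent (suc v) α j h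
canon-ascent v (suc zero ∷ α)    zero    (s≤s h) = <ᵇ-true (entry-canon-1 (suc v) α h)
canon-ascent v (suc (suc a) ∷ α) zero    h       = <ᵇ-irrefl v
canon-ascent v (suc a ∷ α)       (suc j) (s≤s h) = canon-ascent v (a ∷ α) j h

all-cong : ∀ {p q : ℕ → Bool} {xs} → All (λ x → p x ≡ q x) xs → all p xs ≡ all q xs
all-cong []        = refl
all-cong (eq ∷ eqs) = cong₂ _∧_ eq (all-cong eqs)

FWord : ℕ → List ℕ → List ℕ → List ℕ → Set
FWord N J α is = (Sorted is × Content α is) ×
                 length is ≡ N × T (all (λ j → entry is j <ᵇ entry is (suc j)) J)

-- The list counted by `F` is filtered by a test local to that definition, so it appears here only
-- through its existence and its length.
enum-F : ∀ N J α → ∃ λ xs → Enumerates (FWord N J α) xs × length xs ≡ F N J α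
enum-F N J α = _ , enum-resp (enum-filterᵇ _ (enum-allLists N (unique-range1 (length α)))) to from , refl
  where
  strict : List ℕ → Bool
  strict is = all (λ j → entry is j <ᵇ entry is (suc j)) J
  to : ∀ {is} → (length is ≡ N × All (_∈ range1 (length α)) is) ×
                T (nondec is ∧ (strict is ∧ hasContent α is)) → FWord N J α is
  to {is} ((l , a) , t) with t₁ , t₂₃ ← ∧⁻ {nondec is} t with t₂ , t₃ ← ∧⁻ {strict is} t₂₃ =
    (nondec⁻ is t₁ , content⁻ α a t₃) , l , t₂
  from : ∀ {is} → FWord N J α is → (length is ≡ N × All (_∈ range1 (length α)) is) ×
                T (nondec is ∧ (strict is ∧ hasContent α is))
  from ((s , c) , l , t) with a , h ← content⁺ α c = (l , a) , ∧⁺ (nondec⁺ s) (∧⁺ t h)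

-- Sortedness and content leave only `canon 1 α`, of length `sum α`; the remaining question is
-- whether it ascends at all positions of `J`.
F-eval : ∀ {N} {J} {α} → All (λ j → 1 ≤ j × suc j ≤ N) J →
         F N J α ≡ (if sum α ≡ᵇ N then (if all (bnd α) J then 1 else 0) else 0)
F-eval {N} {J} {α} J⊆ with xs , e , eq ← enum-F N J α with sum α ≟ N
... | no  ≢N rewrite ≢⇒≡ᵇ ≢N = trans (sym eq) (enum-length e (enum-[] {P = λ _ → ⊥} id)
  (λ { ((s , c) , l , _) → ≢N (trans (sym (length-canon 1 α)) (trans (cong length (sym (canon-unique α s c))) l)) })
  λ ())
... | yes refl rewrite ≡ᵇ-refl (sum α) = trans (sym eq) count
  where
  ascents : all (λ j → entry (canon 1 α) j <ᵇ entry (canon 1 α) (suc j)) J ≡ all (bnd α) J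
  ascents = all-cong (All.map (λ { {suc j} (_ , j<) → canon-ascent 1 α j j< }) J⊆)
  count : length xs ≡ (if all (bnd α) J then 1 else 0)
  count with all (bnd α) J | ascents
  ... | true  | asc = enum-length e enum-[ canon 1 α ]
    (λ { ((s , c) , _) → canon-unique α s c })
    (λ { refl → (sorted-canon 1 α , content-canon α) , length-canon 1 α , subst T (sym asc) tt })
  ... | false | asc = enum-length e (enum-[] {P = λ _ → ⊥} id)
    (λ { {is} ((s , c) , _ , t) → subst T asc
          (subst (λ is → T (all (λ j → entry is j <ᵇ entry is (suc j)) J)) (canon-unique α s c) t) })
    λ ()

-- Matchings

length-filterᵇ-map : {A B : Set} (P : B → Bool) (g : A → B) (xs : List A) →
                     length (filterᵇ P (map g xs)) ≡ length (filterᵇ (P ∘ g) xs)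
length-filterᵇ-map P g []       = refl
length-filterᵇ-map P g (x ∷ xs) with P (g x)
... | true  = cong suc (length-filterᵇ-map P g xs)
... | false = length-filterᵇ-map P g xs

cnt : (ℕ → Bool) → ℕ → ℕ
cnt P n = length (filterᵇ P (range1 n))

cnt-suc : ∀ P n → cnt P (suc n) ≡ (if P 1 then 1 else 0) + cnt (P ∘ suc) n
cnt-suc P n = trans (first (P 1) refl) (cong ((if P 1 then 1 else 0) +_)
  (trans (length-filterᵇ-map P suc (applyUpTo suc n))
         (cong (length ∘ filterᵇ (P ∘ suc)) (sym (map-upTo suc n)))))
  where
  rest = map suc (applyUpTo suc n)
  first : ∀ b → P 1 ≡ b → length (filterᵇ P (1 ∷ rest)) ≡ (if P 1 then 1 else 0) + length (filterᵇ P rest)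
  first true  eq rewrite eq = refl
  first false eq rewrite eq = refl

cnt-cong : ∀ {P P′} n → (∀ {i} → InR n i → P i ≡ P′ i) → cnt P n ≡ cnt P′ n
cnt-cong {P} {P′} n eq = go (range1 n) (All.tabulate (eq ∘ ∈-range1⁻))
  where
  go : ∀ xs → All (λ i → P i ≡ P′ i) xs → length (filterᵇ P xs) ≡ length (filterᵇ P′ xs)
  go []       []        = refl
  go (x ∷ xs) (eq ∷ eqs) with P x | P′ x | eq
  ... | true  | .true  | refl = cong suc (go xs eqs)
  ... | false | .false | refl = go xs eqs

length-range1 : ∀ n → length (range1 n) ≡ n
length-range1 n = trans (length-map suc (upTo n)) (length-upTo n)

cnt-≤ : ∀ P n → cnt P n ≤ n
cnt-≤ P n = ≤-trans (length-filter (T? ∘ P) (range1 n)) (≤-reflexive (length-range1 n))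

entry-tabulate : ∀ (g : ℕ → ℕ) {n i} → InR n i → entry (map g (range1 n)) i ≡ g i
entry-tabulate g {n} {suc i} (_ , i<n) = go id n i i<n
  where
  go : ∀ h n i → i < n → entry (map g (map suc (applyUpTo h n))) (suc i) ≡ g (suc (h i))
  go h (suc n) zero    _         = refl
  go h (suc n) (suc i) (s≤s i<n) = go (h ∘ suc) n i i<n

length-tabulate : ∀ (g : ℕ → ℕ) n → length (map g (range1 n)) ≡ n
length-tabulate g n = trans (length-map g (range1 n)) (length-range1 n)

entry-ext : ∀ {n xs ys} → length xs ≡ n → length ys ≡ n →
            (∀ {i} → InR n i → entry xs i ≡ entry ys i) → xs ≡ ys
entry-ext {zero}  {[]}     {[]}     _ _ _  = refl
entry-ext {suc n} {x ∷ xs} {y ∷ ys} l l′ eq = cong₂ _∷_ (eq (s≤s z≤n , s≤s z≤n))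
  (entry-ext (suc-injective l) (suc-injective l′)
    λ { {suc i} (_ , i≤) → eq (s≤s z≤n , s≤s i≤) })

entries⁻ : ∀ {P : ℕ → Set} {xs} → All P xs → ∀ {i} → InR (length xs) i → P (entry xs i)
entries⁻ (p ∷ _)  {suc zero}    _              = p
entries⁻ (_ ∷ ps) {suc (suc i)} (_ , s≤s i≤) = entries⁻ ps (s≤s z≤n , i≤)

entries⁺ : ∀ {P : ℕ → Set} xs → (∀ {i} → InR (length xs) i → P (entry xs i)) → All P xs
entries⁺ []       _ = []
entries⁺ (x ∷ xs) h = h (s≤s z≤n , s≤s z≤n) ∷
  entries⁺ xs λ { {suc i} (_ , i≤) → h (s≤s z≤n , s≤s i≤) }

record Mat (N f : ℕ) (p : List ℕ) : Set where
  field
    len : length p ≡ N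
    ran : ∀ {i} → InR N i → InR N (entry p i)
    inv : ∀ {i} → InR N i → entry p (entry p i) ≡ i
    unm : cnt (λ i → entry p i ≡ᵇ i) N ≡ f

open Mat

enum-matchings : ∀ N f → Enumerates (Mat N f) (matchingsF N f)
enum-matchings N f = enum-resp
  (enum-filterᵇ _ (enum-filterᵇ isInvolution (enum-allLists N (unique-range1 N)))) to from
  where
  to : ∀ {p} → ((length p ≡ N × All (_∈ range1 N) p) × T (isInvolution p)) × T (unmatched p ≡ᵇ f) →
       Mat N f p
  to {p} (((refl , a) , i) , u) = record
    { len = refl
    ; ran = ∈-range1⁻ ∘ entries⁻ a
    ; inv = λ i∈ → ≡ᵇ⇒≡ _ _ (all-range1⁻ {length p} _ i i∈)
    ; unm = ≡ᵇ⇒≡ _ _ u }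
  from : ∀ {p} → Mat N f p →
         ((length p ≡ N × All (_∈ range1 N) p) × T (isInvolution p)) × T (unmatched p ≡ᵇ f)
  from {p} record { len = refl ; ran = r ; inv = i ; unm = u } =
    ((refl , entries⁺ p (∈-range1⁺ ∘ r)) , all-range1⁺ {length p} _ (λ i∈ → ≡⇒≡ᵇ _ _ (i i∈))) , ≡⇒≡ᵇ _ _ u

Shorts⊆ : ℕ → List ℕ → List ℕ → Set
Shorts⊆ N α p = ∀ {j} → 1 ≤ j → suc j ≤ N → entry p j ≡ suc j → T (bnd α j)

∈-Short⁻ : ∀ p {j} → j ∈ Short p → 1 ≤ j × suc j ≤ length p × entry p j ≡ suc j
∈-Short⁻ p {j} j∈ with j∈r , t ← ∈-filter⁻ (λ i → T? (entry p i ≡ᵇ suc i)) j∈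
  with 1≤j , j≤ ← ∈-range1⁻ {length p ∸ 1} j∈r = 1≤j , lt (length p) 1≤j j≤ , ≡ᵇ⇒≡ _ _ t
  where
  lt : ∀ n → 1 ≤ j → j ≤ n ∸ 1 → suc j ≤ n
  lt zero    1≤j j≤ = contradiction (≤-trans 1≤j j≤) λ ()
  lt (suc n) _   j≤ = s≤s j≤

∈-Short⁺ : ∀ p {j} → 1 ≤ j → suc j ≤ length p → entry p j ≡ suc j → j ∈ Short p
∈-Short⁺ p {j} 1≤j j< eq =
  ∈-filter⁺ (λ i → T? (entry p i ≡ᵇ suc i)) (∈-range1⁺ (1≤j , ∸-monoˡ-≤ 1 j<)) (≡⇒≡ᵇ _ _ eq)

matchingCount : ℕ → ℕ → List ℕ → ℕ
matchingCount N f α = length (filterᵇ (λ p → all (bnd α) (Short p)) (matchingsF N f))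

enum-matchingCount : ∀ N f α → Enumerates (λ p → Mat N f p × Shorts⊆ N α p)
                              (filterᵇ (λ p → all (bnd α) (Short p)) (matchingsF N f))
enum-matchingCount N f α = enum-resp (enum-filterᵇ _ (enum-matchings N f)) to from
  where
  to : ∀ {p} → Mat N f p × T (all (bnd α) (Short p)) → Mat N f p × Shorts⊆ N α p
  to {p} (m , t) = m , λ {j} 1≤j j< eq → All.lookup (All.all⁺ (bnd α) (Short p) t)
    (∈-Short⁺ p 1≤j (≤-trans j< (≤-reflexive (sym (len m)))) eq)
  from : ∀ {p} → Mat N f p × Shorts⊆ N α p → Mat N f p × T (all (bnd α) (Short p))
  from {p} (m , s) = m , All.all⁻ (bnd α) (All.tabulate λ j∈ →
    let 1≤j , j< , eq = ∈-Short⁻ p j∈ in s 1≤j (≤-trans j< (≤-reflexive (len m))) eq)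

-- Short chords start at positive positions, so `bnd` is never consulted at 0, the one place where a
-- leading empty block can show.
matchingCount-cong : ∀ N f α β → (∀ {j} → 1 ≤ j → bnd α j ≡ bnd β j) → matchingCount N f α ≡ matchingCount N f β
matchingCount-cong N f α β eq = enum-length (enum-matchingCount N f α) (enum-matchingCount N f β)
  (λ (m , s) → m , λ 1≤j j< e → subst T (eq 1≤j) (s 1≤j j< e))
  (λ (m , s) → m , λ 1≤j j< e → subst T (sym (eq 1≤j)) (s 1≤j j< e))

matchingCount-< : ∀ {N f} α → N < f → matchingCount N f α ≡ 0
matchingCount-< {N} {f} α N<f = enum-length (enum-matchingCount N f α) (enum-[] {P = λ _ → ⊥} id)
  (λ (m , _) → <⇒≱ N<f (≤-trans (≤-reflexive (sym (unm m))) (cnt-≤ _ N))) λ ()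

-- δ a is the increasing enumeration of the numbers other than a + 1 and a + 2.
δ : ℕ → ℕ → ℕ
δ _       zero    = 0
δ zero    (suc x) = 3 + x
δ (suc a) (suc x) = suc (δ a x)

δ-view : ∀ a y → y ≡ 1 + a ⊎ y ≡ 2 + a ⊎ ∃ λ x → y ≡ δ a x
δ-view a       0                   = inj₂ (inj₂ (0 , refl))
δ-view zero    1                   = inj₁ refl
δ-view zero    2                   = inj₂ (inj₁ refl)
δ-view zero    (suc (suc (suc y))) = inj₂ (inj₂ (suc y , refl))
δ-view (suc a) (suc y) with δ-view a y
... | inj₁ refl              = inj₁ refl
... | inj₂ (inj₁ refl)       = inj₂ (inj₁ refl)
... | inj₂ (inj₂ (x , refl)) = inj₂ (inj₂ (suc x , refl))

δ-injective : ∀ a {x y} → δ a x ≡ δ a y → x ≡ y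
δ-injective a       {zero}  {zero}  eq = refl
δ-injective zero    {suc x} {suc y} eq = cong suc (+-cancelˡ-≡ 3 x y eq)
δ-injective (suc a) {suc x} {suc y} eq = cong suc (δ-injective a (suc-injective eq))
δ-injective zero    {zero}  {suc y} ()
δ-injective (suc a) {zero}  {suc y} ()
δ-injective zero    {suc x} {zero}  ()
δ-injective (suc a) {suc x} {zero}  ()

δ≢1+a : ∀ a x → δ a x ≢ 1 + a
δ≢1+a zero    (suc x) ()
δ≢1+a (suc a) (suc x) eq = δ≢1+a a x (suc-injective eq)

δ≢2+a : ∀ a x → δ a x ≢ 2 + a
δ≢2+a zero    (suc x) ()
δ≢2+a (suc a) (suc x) eq = δ≢2+a a x (suc-injective eq)

δ-fix : ∀ a → δ a a ≡ a
δ-fix zero    = refl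
δ-fix (suc a) = cong suc (δ-fix a)

δ-suc⁻ : ∀ a {z} x → δ a z ≡ suc (δ a x) → z ≡ suc x
δ-suc⁻ zero    {suc z}       (suc x) eq = cong suc (+-cancelˡ-≡ 3 z (suc x) eq)
δ-suc⁻ (suc a) {suc zero}    zero    eq = refl
δ-suc⁻ (suc zero)    {suc (suc z)} zero ()
δ-suc⁻ (suc (suc a)) {suc (suc z)} zero ()
δ-suc⁻ (suc a) {suc z}       (suc x) eq = cong suc (δ-suc⁻ a x (suc-injective eq))
δ-suc⁻ zero    {suc z}       zero    ()

-- The image of `δ a` has a single gap, directly after the fixed point `a`.
δ-suc⁺ : ∀ a {x} → x ≢ a → δ a (suc x) ≡ suc (δ a x)
δ-suc⁺ zero    {zero}  x≢a = contradiction refl x≢a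
δ-suc⁺ zero    {suc x} _   = refl
δ-suc⁺ (suc a) {zero}  _   = refl
δ-suc⁺ (suc a) {suc x} x≢a = cong suc (δ-suc⁺ a (x≢a ∘ cong suc))

δ-InR⁺ : ∀ a {n x} → InR n x → InR (2 + n) (δ a x)
δ-InR⁺ a {x = x} (1≤x , x≤n) = pos a 1≤x , ≤-trans (upper a x) (s≤s (s≤s x≤n))
  where
  pos : ∀ a {x} → 1 ≤ x → 1 ≤ δ a x
  pos zero    {suc x} _ = s≤s z≤n
  pos (suc a) {suc x} _ = s≤s z≤n
  upper : ∀ a x → δ a x ≤ 2 + x
  upper a       zero    = z≤n
  upper zero    (suc x) = ≤-refl
  upper (suc a) (suc x) = s≤s (upper a x)

δ-InR⁻ : ∀ {a n} x → a ≤ n → InR (2 + n) (δ a x) → InR n x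
δ-InR⁻ (suc x) a≤n (_ , δ≤) = s≤s z≤n , upper a≤n (suc x) δ≤
  where
  upper : ∀ {a n} → a ≤ n → ∀ x → δ a x ≤ 2 + n → x ≤ n
  upper _         zero    _              = z≤n
  upper z≤n       (suc x) (s≤s (s≤s δ≤)) = δ≤
  upper (s≤s a≤n) (suc x) (s≤s δ≤)       = s≤s (upper a≤n x δ≤)

cnt-δ : ∀ {a n} P → a ≤ n → P (1 + a) ≡ false → P (2 + a) ≡ false → cnt P (2 + n) ≡ cnt (P ∘ δ a) n
cnt-δ {n = n} P z≤n e₁ e₂ = begin
  cnt P (2 + n)                                   ≡⟨ cnt-suc P (suc n) ⟩
  (if P 1 then 1 else 0) + cnt (P ∘ suc) (suc n)  ≡⟨ cong (λ b → (if b then 1 else 0) + cnt (P ∘ suc) (suc n)) e₁ ⟩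
  cnt (P ∘ suc) (suc n)                           ≡⟨ cnt-suc (P ∘ suc) n ⟩
  (if P 2 then 1 else 0) + cnt (P ∘ (2 +_)) n     ≡⟨ cong (λ b → (if b then 1 else 0) + cnt (P ∘ (2 +_)) n) e₂ ⟩
  cnt (P ∘ (2 +_)) n                              ≡⟨ cnt-cong n (λ { {suc i} _ → refl }) ⟩
  cnt (P ∘ δ 0) n                                 ∎
  where open ≡-Reasoning
cnt-δ {suc a} {suc n} P (s≤s a≤n) e₁ e₂ = begin
  cnt P (3 + n)                                     ≡⟨ cnt-suc P (2 + n) ⟩
  (if P 1 then 1 else 0) + cnt (P ∘ suc) (2 + n)    ≡⟨ cong ((if P 1 then 1 else 0) +_) (cnt-δ (P ∘ suc) a≤n e₁ e₂) ⟩
  (if P 1 then 1 else 0) + cnt (P ∘ suc ∘ δ a) n    ≡⟨ cnt-suc (P ∘ δ (suc a)) n ⟨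
  cnt (P ∘ δ (suc a)) (suc n)                       ∎
  where open ≡-Reasoning

bnd-self : ∀ a α → bnd (a ∷ α) a ≡ true
bnd-self zero    α = refl
bnd-self (suc a) α = bnd-self a α

bnd-< : ∀ {a} α {j} → j < a → bnd (a ∷ α) j ≡ false
bnd-< {suc a} α {zero}  _         = refl
bnd-< {suc a} α {suc j} (s≤s j<a) = bnd-< α j<a

-- Positions before the gap stay inside the first block; those after it move by 2, together with all
-- later partial sums. The exception `x = a` is genuine: `a` ends the shortened first block but is
-- not the end of the original one.
bnd-δ : ∀ a b α {x} → x ≢ a → bnd (suc a ∷ suc b ∷ α) (δ a x) ≡ bnd (a ∷ b ∷ α) x
bnd-δ zero    b α {zero}  x≢a = contradiction refl x≢a
bnd-δ zero    b α {suc x} _   = refl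
bnd-δ (suc a) b α {zero}  _   = refl
bnd-δ (suc a) b α {suc x} x≢a = bnd-δ a b α (x≢a ∘ cong suc)

bnd-merge : ∀ a b α {x} → x ≢ a → bnd (a ∷ b ∷ α) x ≡ bnd (a + b ∷ α) x
bnd-merge zero    b α {zero}  x≢a = contradiction refl x≢a
bnd-merge zero    b α {suc x} _   = refl
bnd-merge (suc a) b α {zero}  _   = refl
bnd-merge (suc a) b α {suc x} x≢a = bnd-merge a b α (x≢a ∘ cong suc)

matchingCount-zeroˡ : ∀ N f b α → matchingCount N f (0 ∷ b ∷ α) ≡ matchingCount N f (b ∷ α)
matchingCount-zeroˡ N f b α = matchingCount-cong N f (0 ∷ b ∷ α) (b ∷ α) λ { (s≤s _) → refl }

matchingCount-zeroʳ : ∀ N f a α → matchingCount N f (a ∷ 0 ∷ α) ≡ matchingCount N f (a + 0 ∷ α)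
matchingCount-zeroʳ N f a α = matchingCount-cong N f (a ∷ 0 ∷ α) (a + 0 ∷ α) λ {j} _ → eq j
  where
  eq : ∀ j → bnd (a ∷ 0 ∷ α) j ≡ bnd (a + 0 ∷ α) j
  eq j with j ≟ a
  ... | no  j≢a  = bnd-merge a 0 α j≢a
  ... | yes refl rewrite +-identityʳ j = trans (bnd-self j _) (sym (bnd-self j α))

-- p arises from the matching q on [n] by inserting the chord (a + 1, a + 2).
record Inserted (a n : ℕ) (p q : List ℕ) : Set where
  field
    chordˡ : entry p (1 + a) ≡ 2 + a
    chordʳ : entry p (2 + a) ≡ 1 + a
    other  : ∀ {x} → InR n x → entry p (δ a x) ≡ δ a (entry q x)

open Inserted

module _ {a n f : ℕ} (a≤n : a ≤ n) {p q : List ℕ} (ins : Inserted a n p q) where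

  private
    unmatched-δ : (∀ {x} → InR n x → InR n (entry q x)) →
                  cnt (λ i → entry p i ≡ᵇ i) (2 + n) ≡ cnt (λ i → entry q i ≡ᵇ i) n
    unmatched-δ r = trans
      (cnt-δ (λ i → entry p i ≡ᵇ i) a≤n
        (trans (cong (_≡ᵇ 1 + a) (chordˡ ins)) (≢⇒≡ᵇ (1+n≢n {a})))
        (trans (cong (_≡ᵇ 2 + a) (chordʳ ins)) (≢⇒≡ᵇ {a} {suc a} (1+n≢n ∘ sym))))
      (cnt-cong n λ {x} x∈ → trans (cong (_≡ᵇ δ a x) (other ins x∈)) (δ-≡ᵇ (entry q x) x))
      where
      δ-≡ᵇ : ∀ x y → (δ a x ≡ᵇ δ a y) ≡ (x ≡ᵇ y)
      δ-≡ᵇ x y with x ≟ y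
      ... | yes refl = trans (≡ᵇ-refl (δ a x)) (sym (≡ᵇ-refl x))
      ... | no  x≢y  = trans (≢⇒≡ᵇ (x≢y ∘ δ-injective a)) (sym (≢⇒≡ᵇ x≢y))

  delete-Mat : length q ≡ n → Mat (2 + n) f p → Mat n f q
  delete-Mat l m = record
    { len = l
    ; ran = r
    ; inv = λ {x} x∈ → δ-injective a (begin
        δ a (entry q (entry q x))    ≡⟨ other ins (r x∈) ⟨
        entry p (δ a (entry q x))    ≡⟨ cong (entry p) (other ins x∈) ⟨
        entry p (entry p (δ a x))    ≡⟨ inv m (δ-InR⁺ a x∈) ⟩
        δ a x                        ∎)
    ; unm = trans (sym (unmatched-δ r)) (unm m) }
    where
    open ≡-Reasoning
    r : ∀ {x} → InR n x → InR n (entry q x)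
    r {x} x∈ = δ-InR⁻ (entry q x) a≤n (subst (InR (2 + n)) (other ins x∈) (ran m (δ-InR⁺ a x∈)))

  insert-Mat : length p ≡ 2 + n → Mat n f q → Mat (2 + n) f p
  insert-Mat l m = record
    { len = l
    ; ran = r
    ; inv = i
    ; unm = trans (unmatched-δ (ran m)) (unm m) }
    where
    r : ∀ {y} → InR (2 + n) y → InR (2 + n) (entry p y)
    r {y} y∈ with δ-view a y
    ... | inj₁ refl              = subst (InR (2 + n)) (sym (chordˡ ins)) (s≤s z≤n , s≤s (s≤s a≤n))
    ... | inj₂ (inj₁ refl)       = subst (InR (2 + n)) (sym (chordʳ ins)) (s≤s z≤n , s≤s (m≤n⇒m≤1+n a≤n))
    ... | inj₂ (inj₂ (x , refl)) = let x∈ = δ-InR⁻ x a≤n y∈ in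
      subst (InR (2 + n)) (sym (other ins x∈)) (δ-InR⁺ a (ran m x∈))
    i : ∀ {y} → InR (2 + n) y → entry p (entry p y) ≡ y
    i {y} y∈ with δ-view a y
    ... | inj₁ refl              = trans (cong (entry p) (chordˡ ins)) (chordʳ ins)
    ... | inj₂ (inj₁ refl)       = trans (cong (entry p) (chordʳ ins)) (chordˡ ins)
    ... | inj₂ (inj₂ (x , refl)) = let x∈ = δ-InR⁻ x a≤n y∈ in
      trans (cong (entry p) (other ins x∈)) (trans (other ins (ran m x∈)) (cong (δ a) (inv m x∈)))

  delete-Shorts : ∀ {b α} → Shorts⊆ (2 + n) (suc a ∷ suc b ∷ α) p → Shorts⊆ n (a ∷ b ∷ α) q
  delete-Shorts {b} {α} s {j} 1≤j j<n eq with j ≟ a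
  -- The newly short chord `(a, a + 1)` of `q` is `(a, a + 3)` in `p`, around the deleted chord; it
  -- lies across the first cut.
  ... | yes refl = subst T (sym (bnd-self j (b ∷ α))) tt
  ... | no  j≢a  = subst T (bnd-δ a b α j≢a)
    (s (proj₁ (δ-InR⁺ a j∈)) (subst (_≤ 2 + n) δ-suc (proj₂ (δ-InR⁺ a (s≤s z≤n , j<n))))
       (trans (other ins j∈) (trans (cong (δ a) eq) δ-suc)))
    where
    j∈ : InR n j
    j∈ = 1≤j , <⇒≤ j<n
    δ-suc = δ-suc⁺ a j≢a

  insert-Shorts : ∀ {b α} → Mat n f q → Shorts⊆ n (a ∷ b ∷ α) q → Shorts⊆ (2 + n) (suc a ∷ suc b ∷ α) p
  insert-Shorts {b} {α} m s {y} 1≤y y< eq with δ-view a y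
  ... | inj₁ refl        = subst T (sym (bnd-self a (suc b ∷ α))) tt
  ... | inj₂ (inj₁ refl) = contradiction (trans (sym (chordʳ ins)) eq) (<⇒≢ (s≤s (n≤1+n (1 + a))))
  ... | inj₂ (inj₂ (x , refl)) = subst T (sym (bnd-δ a b α x≢a)) (s (proj₁ x∈) x<n qx)
    where
    x∈ : InR n x
    x∈ = δ-InR⁻ x a≤n (1≤y , <⇒≤ y<)
    δqx : δ a (entry q x) ≡ suc (δ a x)
    δqx = trans (sym (other ins x∈)) eq
    qx : entry q x ≡ suc x
    qx = δ-suc⁻ a x δqx
    x<n : suc x ≤ n
    x<n = subst (_≤ n) qx (proj₂ (ran m x∈))
    -- A short chord starting at `a` would end at `a + 1`, which already belongs to the inserted
    -- chord.
    x≢a : x ≢ a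
    x≢a refl = δ≢1+a x (entry q x) (trans δqx (cong suc (δ-fix x)))

inserted-unique : ∀ {a n p p′ q} → a ≤ n → length p ≡ 2 + n → length p′ ≡ 2 + n →
                  Inserted a n p q → Inserted a n p′ q → p ≡ p′
inserted-unique {a} {n} {p} {p′} a≤n l l′ ins ins′ = entry-ext l l′ eq
  where
  eq : ∀ {y} → InR (2 + n) y → entry p y ≡ entry p′ y
  eq {y} y∈ with δ-view a y
  ... | inj₁ refl              = trans (chordˡ ins) (sym (chordˡ ins′))
  ... | inj₂ (inj₁ refl)       = trans (chordʳ ins) (sym (chordʳ ins′))
  ... | inj₂ (inj₂ (x , refl)) = let x∈ = δ-InR⁻ x a≤n y∈ in trans (other ins x∈) (sym (other ins′ x∈))

deleted-unique : ∀ {a n p q q′} → length q ≡ n → length q′ ≡ n →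
                 Inserted a n p q → Inserted a n p q′ → q ≡ q′
deleted-unique {a} l l′ ins ins′ = entry-ext l l′ λ x∈ →
  δ-injective a (trans (sym (other ins x∈)) (other ins′ x∈))

insert : ∀ {a n} q → a ≤ n → ∃ λ p → length p ≡ 2 + n × Inserted a n p q
insert {a} {n} q a≤n = map g (range1 (2 + n)) , length-tabulate g (2 + n) , record
  { chordˡ = trans (entry-tabulate g (s≤s z≤n , s≤s (m≤n⇒m≤1+n a≤n))) g₁
  ; chordʳ = trans (entry-tabulate g (s≤s z≤n , s≤s (s≤s a≤n))) g₂
  ; other  = λ {x} x∈ → trans (entry-tabulate g (δ-InR⁺ a x∈)) (gδ x) }
  where
  g : ℕ → ℕ
  g y with δ-view a y
  ... | inj₁ _              = 2 + a
  ... | inj₂ (inj₁ _)       = 1 + a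
  ... | inj₂ (inj₂ (x , _)) = δ a (entry q x)
  g₁ : g (1 + a) ≡ 2 + a
  g₁ with δ-view a (1 + a)
  ... | inj₁ _               = refl
  ... | inj₂ (inj₁ eq)       = contradiction (sym eq) 1+n≢n
  ... | inj₂ (inj₂ (x , eq)) = contradiction (sym eq) (δ≢1+a a x)
  g₂ : g (2 + a) ≡ 1 + a
  g₂ with δ-view a (2 + a)
  ... | inj₁ eq              = contradiction eq 1+n≢n
  ... | inj₂ (inj₁ _)        = refl
  ... | inj₂ (inj₂ (x , eq)) = contradiction (sym eq) (δ≢2+a a x)
  gδ : ∀ x → g (δ a x) ≡ δ a (entry q x)
  gδ x with δ-view a (δ a x)
  ... | inj₁ eq               = contradiction eq (δ≢1+a a x)
  ... | inj₂ (inj₁ eq)        = contradiction eq (δ≢2+a a x)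
  ... | inj₂ (inj₂ (x′ , eq)) = cong (δ a ∘ entry q) (δ-injective a (sym eq))

delete : ∀ {a n f p} → a ≤ n → Mat (2 + n) f p → entry p (1 + a) ≡ 2 + a →
         ∃ λ q → length q ≡ n × Inserted a n p q
delete {a} {n} {f} {p} a≤n m eqˡ = map g (range1 n) , length-tabulate g n , record
  { chordˡ = eqˡ
  ; chordʳ = eqʳ
  ; other  = λ {x} x∈ → trans (δσ (δ-InR⁺ a x∈) (δ≢1+a a x) (δ≢2+a a x))
                              (cong (δ a) (sym (entry-tabulate g x∈))) }
  where
  -- A left inverse of `δ a`. Its default 0 is never met: as `p` is an involution, only the ends of
  -- the chord are sent to the ends of the chord.
  σ : ℕ → ℕ
  σ y with δ-view a y
  ... | inj₂ (inj₂ (x , _)) = x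
  ... | _                   = 0
  g : ℕ → ℕ
  g x = σ (entry p (δ a x))
  eqʳ : entry p (2 + a) ≡ 1 + a
  eqʳ = trans (cong (entry p) (sym eqˡ)) (inv m (s≤s z≤n , s≤s (m≤n⇒m≤1+n a≤n)))
  δσ : ∀ {y} → InR (2 + n) y → y ≢ 1 + a → y ≢ 2 + a → entry p y ≡ δ a (σ (entry p y))
  δσ {y} y∈ ≢1 ≢2 with δ-view a (entry p y)
  ... | inj₁ eq              =
    contradiction (trans (sym (inv m y∈)) (trans (cong (entry p) eq) eqˡ)) ≢2
  ... | inj₂ (inj₁ eq)       =
    contradiction (trans (sym (inv m y∈)) (trans (cong (entry p) eq) eqʳ)) ≢1
  ... | inj₂ (inj₂ (x , eq)) = eq

-- The last term counts the matchings with the chord (a + 1, a + 2), which is deleted.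
matchingCount-rec : ∀ {a n} f b α → a ≤ n →
  matchingCount (2 + n) f (suc a ∷ suc b ∷ α) ≡
  matchingCount (2 + n) f (suc a + suc b ∷ α) + matchingCount n f (a ∷ b ∷ α)
matchingCount-rec {a} {n} f b α a≤n = trans
  (length-≡ R (enum-matchingCount (2 + n) f β)
              (enum-⊎ (enum-matchingCount (2 + n) f γ) (enum-matchingCount n f (a ∷ b ∷ α)))
              total surj inj fun)
  (length-⊎ (filterᵇ (λ p → all (bnd γ) (Short p)) (matchingsF (2 + n) f))
            (filterᵇ (λ p → all (bnd (a ∷ b ∷ α)) (Short p)) (matchingsF n f)))
  where
  β γ : List ℕ
  β = suc a ∷ suc b ∷ α
  γ = suc a + suc b ∷ α
  P P₁ P₂ : List ℕ → Set
  P  p = Mat (2 + n) f p × Shorts⊆ (2 + n) β p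
  P₁ p = Mat (2 + n) f p × Shorts⊆ (2 + n) γ p
  P₂ q = Mat n f q × Shorts⊆ n (a ∷ b ∷ α) q
  R : List ℕ → List ℕ ⊎ List ℕ → Set
  R p (inj₁ p′) = p ≡ p′
  R p (inj₂ q)  = Inserted a n p q
  -- Position `suc a` is interior to the merged block, so the first summand contains no matching
  -- with the chord to be deleted. This keeps the two cases apart.
  notShort : ∀ {p} → P₁ p → entry p (1 + a) ≢ 2 + a
  notShort (_ , s) eq = subst T (bnd-< α (m<m+n (suc a) (s≤s z≤n))) (s (s≤s z≤n) (s≤s (s≤s a≤n)) eq)
  total : ∀ {p} → P p → ∃ λ z → (P₁ ⊎ᵖ P₂) z × R p z
  total {p} (m , s) with entry p (1 + a) ≟ 2 + a
  ... | yes eq with q , l , ins ← delete a≤n m eq =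
    inj₂ q , inʳ (delete-Mat a≤n ins l m , delete-Shorts {f = f} a≤n ins s) , ins
  ... | no ≢ = inj₁ p , inˡ (m , s′) , refl
    where
    s′ : Shorts⊆ (2 + n) γ p
    s′ {j} 1≤j j< eq with j ≟ suc a
    ... | yes refl = contradiction eq ≢
    ... | no  j≢   = subst T (bnd-merge (suc a) (suc b) α j≢) (s 1≤j j< eq)
  surj : ∀ {z} → (P₁ ⊎ᵖ P₂) z → ∃ λ p → P p × R p z
  surj (inˡ {p} (m , s)) = p , (m , s′) , refl
    where
    s′ : Shorts⊆ (2 + n) β p
    s′ {j} 1≤j j< eq with j ≟ suc a
    ... | yes refl = contradiction eq (notShort (m , s))
    ... | no  j≢   = subst T (sym (bnd-merge (suc a) (suc b) α j≢)) (s 1≤j j< eq)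
  surj (inʳ {q} (m , s)) with p , l , ins ← insert q a≤n =
    p , (insert-Mat a≤n ins l m , insert-Shorts a≤n ins m s) , ins
  inj : ∀ {p p′ z} → P p → P p′ → (P₁ ⊎ᵖ P₂) z → R p z → R p′ z → p ≡ p′
  inj _       _        (inˡ _) refl refl = refl
  inj (m , _) (m′ , _) (inʳ _) r    r′   = inserted-unique a≤n (len m) (len m′) r r′
  fun : ∀ {p z z′} → P p → (P₁ ⊎ᵖ P₂) z → (P₁ ⊎ᵖ P₂) z′ → R p z → R p z′ → z ≡ z′
  fun _ (inˡ _)       (inˡ _)        refl refl = refl
  fun _ (inˡ p₁)      (inʳ _)        refl r    = contradiction (chordˡ r) (notShort p₁)
  fun _ (inʳ _)       (inˡ p₁)       r    refl = contradiction (chordˡ r) (notShort p₁)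
  fun _ (inʳ (m , _)) (inʳ (m′ , _)) r    r′   = cong inj₂ (deleted-unique (len m) (len m′) r r′)

isEmptyShort⁺ : ∀ p → Short p ≡ [] → T (isEmptyShort p)
isEmptyShort⁺ p eq with Short p | eq
... | [] | refl = tt

isEmptyShort⁻ : ∀ p → T (isEmptyShort p) → Short p ≡ []
isEmptyShort⁻ p t with Short p
... | [] = refl

-- A single positive block ends only at `N`, beyond the start of every possible short chord, so none
-- is allowed.
matchingCount-[_] : ∀ N f → matchingCount N f (N ∷ []) ≡ noShortCount N f
matchingCount-[_] N f = enum-length (enum-matchingCount N f (N ∷ [])) (enum-filterᵇ isEmptyShort (enum-matchings N f))
  (λ {p} (m , s) → m , isEmptyShort⁺ p (noMember λ j∈ →
    let 1≤j , j< , eq = ∈-Short⁻ p j∈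
        j<N = ≤-trans j< (≤-reflexive (len m))
    in subst T (bnd-< [] j<N) (s 1≤j j<N eq)))
  (λ {p} (m , t) → m , λ 1≤j j< eq →
    ⊥-elim (nothing (isEmptyShort⁻ p t) (∈-Short⁺ p 1≤j (≤-trans j< (≤-reflexive (sym (len m)))) eq)))
  where
  noMember : ∀ {xs : List ℕ} → (∀ {j} → j ∈ xs → ⊥) → xs ≡ []
  noMember {[]}    _ = refl
  noMember {_ ∷ _} h = ⊥-elim (h (here refl))
  nothing : ∀ {xs : List ℕ} {j} → xs ≡ [] → j ∈ xs → ⊥
  nothing refl ()

Q-eval : ∀ N f α → Q N Short (matchingsF N f) α ≡ (if sum α ≡ᵇ N then matchingCount N f α else 0)
Q-eval N f α = go (matchingsF N f) (All.tabulate (len ∘ sound (enum-matchings N f)))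
  where
  go : ∀ ps → All (λ p → length p ≡ N) ps → sum (map (λ p → F N (Short p) α) ps) ≡
       (if sum α ≡ᵇ N then length (filterᵇ (λ p → all (bnd α) (Short p)) ps) else 0)
  go [] [] with sum α ≡ᵇ N
  ... | true  = refl
  ... | false = refl
  go (p ∷ ps) (l ∷ ls)
    rewrite F-eval {N} {Short p} {α} (All.tabulate λ j∈ →
              let 1≤j , j< , _ = ∈-Short⁻ p j∈ in 1≤j , ≤-trans j< (≤-reflexive l))
          | go ps ls
    with sum α ≡ᵇ N | all (bnd α) (Short p)
  ... | true  | true  = refl
  ... | true  | false = refl
  ... | false | _     = refl

-- Two-row tableaux

Row : List ℕ → List ℕ → ℕ → Set
Row vs row r = (length row ≡ r × All (_∈ vs) row) × T (nondec row)

enum-rowFillings : ∀ rs {vs} → Unique vs → Enumerates (λ t → Pointwise (Row vs) t rs) (rowFillings rs vs)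
enum-rowFillings []       u = record
  { unique = [] ∷ [] ; sound = λ { (here refl) → [] } ; complete = λ { [] → here refl } }
enum-rowFillings (r ∷ rs) {vs} u = record
  { unique   = unique-prepend (λ _ → rowFillings rs vs) (unique rows) (λ _ → unique IH)
  ; sound    = snd
  ; complete = λ { (row ∷ t) → ∈-prepend⁺ (λ _ → rowFillings rs vs) (complete rows row) (complete IH t) } }
  where
  IH = enum-rowFillings rs u
  rows = enum-filterᵇ nondec (enum-allLists r u)
  snd : ∀ {t} → t ∈ rowFillings (r ∷ rs) vs → Pointwise (Row vs) t (r ∷ rs)
  snd t∈ with _ , _ , refl , row∈ , t∈′ ← ∈-prepend⁻ (λ _ → rowFillings rs vs) (filterᵇ nondec (allLists r vs)) t∈ =
    sound rows row∈ ∷ sound IH t∈′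

data Columns : List ℕ → List ℕ → Set where
  []  : ∀ {xs} → Columns xs []
  _∷_ : ∀ {x y xs ys} → x < y → Columns xs ys → Columns (x ∷ xs) (y ∷ ys)

columns⁻ : ∀ xs ys → length ys ≤ length xs →
           (∀ {i} → InR (length ys) i → entry xs i < entry ys i) → Columns xs ys
columns⁻ xs       []       _       _ = []
columns⁻ (x ∷ xs) (y ∷ ys) (s≤s l) h = h (s≤s z≤n , s≤s z≤n) ∷
  columns⁻ xs ys l λ { {suc i} (_ , i≤) → h (s≤s z≤n , s≤s i≤) }

columns⁺ : ∀ {xs ys} → Columns xs ys → ∀ {i} → InR (length ys) i → entry xs i < entry ys i
columns⁺ (x<y ∷ _) {suc zero}    _            = x<y
columns⁺ (_ ∷ c)   {suc (suc i)} (_ , s≤s i≤) = columns⁺ c (s≤s z≤n , i≤)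

data Tab (r₁ r₂ : ℕ) (α : List ℕ) : List (List ℕ) → Set where
  tab : ∀ {xs ys} → length xs ≡ r₁ → length ys ≡ r₂ → Sorted xs → Sorted ys → Columns xs ys →
        (∀ p → occ p xs + occ p ys ≡ entry α p) → Tab r₁ r₂ α (xs ∷ ys ∷ [])

content-concat : ∀ {α} xs ys → Content α (concat (xs ∷ ys ∷ [])) → ∀ p → occ p xs + occ p ys ≡ entry α p
content-concat xs ys c p =
  trans (sym (occ-++ p xs ys)) (trans (cong (λ zs → occ p (xs ++ zs)) (sym (++-identityʳ ys))) (c p))

enum-schur : ∀ {r₁ r₂} α → r₂ ≤ r₁ →
  Enumerates (Tab r₁ r₂ α) (filterᵇ (λ t → colStrict t ∧ hasContent α (concat t))
                                    (rowFillings (r₁ ∷ r₂ ∷ []) (range1 (length α))))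
enum-schur {r₁} {r₂} α r₂≤r₁ = enum-resp
  (enum-filterᵇ _ (enum-rowFillings (r₁ ∷ r₂ ∷ []) (unique-range1 (length α)))) to from
  where
  vs = range1 (length α)
  to : ∀ {t} → Pointwise (Row vs) t (r₁ ∷ r₂ ∷ []) × T (colStrict t ∧ hasContent α (concat t)) →
       Tab r₁ r₂ α t
  to {xs ∷ ys ∷ []} (((lx , ax) , nx) ∷ ((ly , ay) , ny) ∷ [] , t)
    with t₁ , t₂ ← ∧⁻ {colStrict (xs ∷ ys ∷ [])} t =
    tab lx ly (nondec⁻ xs nx) (nondec⁻ ys ny)
      (columns⁻ xs ys (subst₂ _≤_ (sym ly) (sym lx) r₂≤r₁)
        (λ i∈ → <ᵇ⇒< _ _ (all-range1⁻ {length ys} _ (proj₁ (∧⁻ t₁)) i∈)))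
      (content-concat {α} xs ys (content⁻ α (All.++⁺ ax (All.++⁺ ay [])) t₂))
  from : ∀ {t} → Tab r₁ r₂ α t →
         Pointwise (Row vs) t (r₁ ∷ r₂ ∷ []) × T (colStrict t ∧ hasContent α (concat t))
  from (tab {xs} {ys} lx ly sx sy c occs)
    with a , t ← content⁺ α {xs ++ (ys ++ [])} (λ p →
      trans (cong (λ zs → occ p (xs ++ zs)) (++-identityʳ ys)) (trans (occ-++ p xs ys) (occs p))) =
    ((lx , All.++⁻ˡ xs a) , nondec⁺ sx) ∷ ((ly , All.++⁻ˡ ys (All.++⁻ʳ xs a)) , nondec⁺ sy) ∷ [] ,
    ∧⁺ (∧⁺ (all-range1⁺ {length ys} (λ j → entry xs j <ᵇ entry ys j) (<⇒<ᵇ ∘ columns⁺ c)) tt) t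

-- The expansion writes its term `k = 0` with a zero part, whereas `partitions` lists the one-row
-- shape without it.
schur-[_] : ∀ r α → schur (r ∷ []) α ≡ schur (r ∷ 0 ∷ []) α
schur-[_] r α = length-≡ R
  (enum-filterᵇ _ (enum-rowFillings (r ∷ []) (unique-range1 (length α))))
  (enum-filterᵇ _ (enum-rowFillings (r ∷ 0 ∷ []) (unique-range1 (length α))))
  (λ { (row ∷ [] , t) → _ , (row ∷ ((refl , []) , tt) ∷ [] , t) , single })
  (λ { {_ ∷ [] ∷ []} (row ∷ ((_ , _) , _) ∷ [] , t) → _ , (row ∷ [] , t) , single
     ; {_ ∷ (_ ∷ _) ∷ []} (_ ∷ ((() , _) , _) ∷ [] , _) })
  (λ { _ _ _ single single → refl }) (λ { _ _ _ single single → refl })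
  where
  data R : List (List ℕ) → List (List ℕ) → Set where
    single : ∀ {xs} → R (xs ∷ []) (xs ∷ [] ∷ [])

-- Identifying the letters 1 and 2

occ-0⁻ : ∀ {v xs} → occ v xs ≡ 0 → All (_≢ v) xs
occ-0⁻ eq = All.tabulate λ { x∈ refl → occ-∈ x∈ eq }

columns-≥ : ∀ {k xs ys} → Columns xs ys → All (k ≤_) xs → All (suc k ≤_) ys
columns-≥ []        _         = []
columns-≥ (x<y ∷ c) (k≤x ∷ a) = ≤-trans (s≤s k≤x) x<y ∷ columns-≥ c a

positive : ∀ {α xs ys} → (∀ p → occ p xs + occ p ys ≡ entry α p) → All (1 ≤_) xs
positive {α} {xs} {ys} occs =
  All.map n≢0⇒n>0 (occ-0⁻ (m+n≡0⇒m≡0 (occ 0 xs) (trans (occs 0) (entry-0 α))))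

merge : ℕ → ℕ
merge 0             = 0
merge 1             = 1
merge (suc (suc x)) = suc x

merge-mono : ∀ {x y} → x ≤ y → merge x ≤ merge y
merge-mono {0}           _             = z≤n
merge-mono {1}     {1}     _           = ≤-refl
merge-mono {1} {suc (suc y)} _         = s≤s z≤n
merge-mono {suc (suc x)} {suc (suc y)} (s≤s x≤y) = x≤y

-- Strictness is lost only for `1 < 2`, and a second row without 2 avoids this pair.
merge-< : ∀ {x y} → 3 ≤ y → x < y → merge x < merge y
merge-< {0}           (s≤s (s≤s (s≤s _))) _         = s≤s z≤n
merge-< {1}           (s≤s (s≤s (s≤s _))) _         = s≤s (s≤s z≤n)
merge-< {suc (suc x)} (s≤s (s≤s (s≤s _))) (s≤s x<y) = x<y

suc-merge : ∀ {xs} → All (2 ≤_) xs → map suc (map merge xs) ≡ xs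
suc-merge []                 = refl
suc-merge (s≤s (s≤s _) ∷ a) = cong (_ ∷_) (suc-merge a)

merge-suc : ∀ {xs} → All (1 ≤_) xs → map merge (map suc xs) ≡ xs
merge-suc []           = refl
merge-suc (s≤s _ ∷ a) = cong (_ ∷_) (merge-suc a)

sorted-map : ∀ {g : ℕ → ℕ} → (∀ {x y} → x ≤ y → g x ≤ g y) → ∀ {xs} → Sorted xs → Sorted (map g xs)
sorted-map mono s = AllPairs.map⁺ (AllPairs.map mono s)

columns-merge : ∀ {xs ys} → Columns xs ys → All (3 ≤_) ys → Columns (map merge xs) (map merge ys)
columns-merge []        []        = []
columns-merge (x<y ∷ c) (3≤y ∷ a) = merge-< 3≤y x<y ∷ columns-merge c a

occ-merge-0 : ∀ xs → occ 0 (map merge xs) ≡ occ 0 xs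
occ-merge-0 []                 = refl
occ-merge-0 (0 ∷ xs)           = cong suc (occ-merge-0 xs)
occ-merge-0 (1 ∷ xs)           = occ-merge-0 xs
occ-merge-0 (suc (suc x) ∷ xs) = occ-merge-0 xs

occ-merge-1 : ∀ xs → occ 1 (map merge xs) ≡ occ 1 xs + occ 2 xs
occ-merge-1 []                       = refl
occ-merge-1 (0 ∷ xs)                 = occ-merge-1 xs
occ-merge-1 (1 ∷ xs)                 = cong suc (occ-merge-1 xs)
occ-merge-1 (2 ∷ xs)                 = trans (cong suc (occ-merge-1 xs)) (sym (+-suc (occ 1 xs) (occ 2 xs)))
occ-merge-1 (suc (suc (suc x)) ∷ xs) = occ-merge-1 xs

occ-merge-2+ : ∀ p xs → occ (2 + p) (map merge xs) ≡ occ (3 + p) xs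
occ-merge-2+ p []       = refl
occ-merge-2+ p (0 ∷ xs) = occ-merge-2+ p xs
occ-merge-2+ p (1 ∷ xs) = occ-merge-2+ p xs
occ-merge-2+ p (2 ∷ xs) = occ-merge-2+ p xs
occ-merge-2+ p (suc (suc (suc x)) ∷ xs) with x ≡ᵇ p
... | true  = cong suc (occ-merge-2+ p xs)
... | false = occ-merge-2+ p xs

split-ones : ∀ {xs} → Sorted xs → All (1 ≤_) xs →
             ∃ λ ys → xs ≡ replicate (occ 1 xs) 1 ++ ys × All (2 ≤_) ys × Sorted ys
split-ones []                       _             = [] , refl , [] , []
split-ones {1 ∷ xs} (_ ∷ s) (_ ∷ a) with ys , eq , h , s′ ← split-ones s a = ys , cong (1 ∷_) eq , h , s′
split-ones {suc (suc x) ∷ xs} s@(x≤ ∷ _) _ = suc (suc x) ∷ xs ,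
  cong (λ c → replicate c 1 ++ suc (suc x) ∷ xs) (sym (occ-none {1} {xs} (All.map ≥2⇒≢1 xs≥2))) ,
  s≤s (s≤s z≤n) ∷ xs≥2 , s
  where
  xs≥2 = All.map (≤-trans (s≤s (s≤s z≤n))) x≤
  ≥2⇒≢1 : ∀ {y} → 2 ≤ y → y ≢ 1
  ≥2⇒≢1 (s≤s ()) refl

-- Equal lengths keep the columns aligned. Below the relabelled prefix the upper entry is at most 2
-- and the lower at least 3; beyond it both entries rise by one.
columns-shift : ∀ {us us′ xs ys} → length us ≡ length us′ → All (_≤ 2) us′ → All (2 ≤_) ys →
                Columns (us ++ xs) ys → Columns (us′ ++ map suc xs) (map suc ys)
columns-shift {[]}    {[]}    _ _ _ []        = []
columns-shift {[]}    {[]}    _ _ (_ ∷ h) (x<y ∷ c) = s≤s x<y ∷ columns-shift {[]} {[]} refl [] h c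
columns-shift {_ ∷ _} {_ ∷ _} _ _ _ []        = []
columns-shift {_ ∷ us} {_ ∷ us′} l (u≤2 ∷ a) (2≤y ∷ h) (_ ∷ c) =
  s≤s (≤-trans u≤2 2≤y) ∷ columns-shift {us} {us′} (suc-injective l) a h c

data High : List (List ℕ) → Set where
  high : ∀ {xs ys} → All (3 ≤_) ys → High (xs ∷ ys ∷ [])

data Low : List (List ℕ) → Set where
  low : ∀ {xs ys} → Low ((1 ∷ xs) ∷ (2 ∷ ys) ∷ [])

-- The second row is sorted with entries at least 2, so a 2 in it appears in the first column, and
-- only 1 can stand above it.
low⊎high : ∀ {r₁ r₂ α t} → Tab r₁ r₂ α t → Low t ⊎ High t
low⊎high {α = α} (tab {xs} {ys} _ _ _ sy c occs) = go (positive {α} {xs} {ys} occs) sy c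
  where
  go : ∀ {xs ys} → All (1 ≤_) xs → Sorted ys → Columns xs ys → Low (xs ∷ ys ∷ []) ⊎ High (xs ∷ ys ∷ [])
  go _ _ [] = inj₂ (high [])
  go {1 ∷ _} {2 ∷ _} _ _ (_ ∷ _) = inj₁ low
  go {_ ∷ _} {suc (suc (suc y)) ∷ ys} _ (y≤ ∷ _) (_ ∷ _) =
    inj₂ (high (s≤s (s≤s (s≤s z≤n)) ∷ All.map (≤-trans (s≤s (s≤s (s≤s z≤n)))) y≤))
  go {suc (suc _) ∷ _} {2 ∷ _} _ _ (s≤s (s≤s ()) ∷ _)
  go {suc _ ∷ _} {1 ∷ _} _ _ (s≤s () ∷ _)
  go {0 ∷ _} (() ∷ _) _ _

low-high : ∀ {t} → Low t → ¬ High t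
low-high low (high (s≤s (s≤s ()) ∷ _))

merge-Tab : ∀ {r₁ r₂ a b α t} → Tab r₁ r₂ (a ∷ b ∷ α) t → High t → Tab r₁ r₂ (a + b ∷ α) (map (map merge) t)
merge-Tab {a = a} {b} {α} (tab {xs} {ys} lx ly sx sy c occs) (high h) =
  tab (trans (length-map merge xs) lx) (trans (length-map merge ys) ly)
      (sorted-map merge-mono sx) (sorted-map merge-mono sy) (columns-merge c h) occs′
  where
  open ≡-Reasoning
  occs′ : ∀ p → occ p (map merge xs) + occ p (map merge ys) ≡ entry (a + b ∷ α) p
  occs′ 0 = trans (cong₂ _+_ (occ-merge-0 xs) (occ-merge-0 ys)) (occs 0)
  occs′ 1 = begin
    occ 1 (map merge xs) + occ 1 (map merge ys)          ≡⟨ cong₂ _+_ (occ-merge-1 xs) (occ-merge-1 ys) ⟩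
    (occ 1 xs + occ 2 xs) + (occ 1 ys + occ 2 ys)        ≡⟨ +-assoc (occ 1 xs) _ _ ⟩
    occ 1 xs + (occ 2 xs + (occ 1 ys + occ 2 ys))        ≡⟨ cong (occ 1 xs +_) (+-comm (occ 2 xs) _) ⟩
    occ 1 xs + ((occ 1 ys + occ 2 ys) + occ 2 xs)        ≡⟨ cong (occ 1 xs +_) (+-assoc (occ 1 ys) _ _) ⟩
    occ 1 xs + (occ 1 ys + (occ 2 ys + occ 2 xs))        ≡⟨ +-assoc (occ 1 xs) _ _ ⟨
    (occ 1 xs + occ 1 ys) + (occ 2 ys + occ 2 xs)        ≡⟨ cong₂ _+_ (occs 1) (trans (+-comm (occ 2 ys) _) (occs 2)) ⟩
    a + b                                                ∎
  occs′ (suc (suc p)) = trans (cong₂ _+_ (occ-merge-2+ p xs) (occ-merge-2+ p ys)) (occs (3 + p))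

-- All letters 1 lie in the first row and form its initial segment of length `a + b`. It is
-- rewritten as `a` ones followed by `b` twos, and every other letter is raised by one.
unmerge-Tab : ∀ {r₁ r₂} a b α {t} → Tab r₁ r₂ (a + b ∷ α) t →
              ∃ λ t′ → Tab r₁ r₂ (a ∷ b ∷ α) t′ × High t′ × t ≡ map (map merge) t′
unmerge-Tab a b α (tab {xs} {ys} lx ly sx sy c occs)
  with zs , eq , zs≥2 , sz ← split-ones sx (positive {a + b ∷ α} {xs} {ys} occs) =
  xs′ ∷ ys′ ∷ [] ,
  tab (trans len-xs′ lx) (trans (length-map suc ys) ly) sorted-xs′ (sorted-map s≤s sy)
      (columns-shift len-ones (All.++⁺ (All.replicate⁺ a (s≤s z≤n)) (All.replicate⁺ b ≤-refl)) ys≥2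
        (subst (λ us → Columns us ys) xs≡ c)) occs′ ,
  high ys′≥3 , cong₂ (λ us vs → us ∷ vs ∷ []) (sym merge-xs′) (sym merge-ys′)
  where
  ys≥2 = columns-≥ c (positive {a + b ∷ α} {xs} {ys} occs)
  ones ones′ xs′ ys′ : List ℕ
  ones  = replicate (a + b) 1
  ones′ = replicate a 1 ++ replicate b 2
  xs′   = ones′ ++ map suc zs
  ys′   = map suc ys
  ys′≥3 : All (3 ≤_) ys′
  ys′≥3 = All.map⁺ (All.map s≤s ys≥2)
  zs′≥3 : All (3 ≤_) (map suc zs)
  zs′≥3 = All.map⁺ (All.map s≤s zs≥2)
  ≢-from-≥ : ∀ {k us} → All (suc k ≤_) us → All (_≢ k) us
  ≢-from-≥ = All.map λ { k<k refl → <-irrefl refl k<k }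
  xs≡ : xs ≡ ones ++ zs
  xs≡ = trans eq (cong (λ c → replicate c 1 ++ zs) (trans (sym (+-identityʳ _))
    (trans (cong (occ 1 xs +_) (sym (occ-none (≢-from-≥ ys≥2)))) (occs 1))))
  len-ones : length ones ≡ length ones′
  len-ones = trans (length-replicate (a + b)) (sym (trans (length-++ (replicate a 1))
    (cong₂ _+_ (length-replicate a) (length-replicate b))))
  len-xs′ : length xs′ ≡ length xs
  len-xs′ = trans (length-++ ones′) (trans (cong₂ _+_ (sym len-ones) (length-map suc zs))
    (trans (sym (length-++ ones)) (cong length (sym xs≡))))
  sorted-xs′ : Sorted xs′
  sorted-xs′ = subst Sorted (sym (++-assoc (replicate a 1) (replicate b 2) _))
    (sorted-replicate-++ a
      (All.++⁺ (All.replicate⁺ b (s≤s z≤n)) (All.map (≤-trans (s≤s z≤n)) zs′≥3))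
      (sorted-replicate-++ b (All.map (≤-trans (s≤s (s≤s z≤n))) zs′≥3) (sorted-map s≤s sz)))
  merge-ones : ∀ a b → map merge (replicate a 1 ++ replicate b 2) ≡ replicate (a + b) 1
  merge-ones (suc a) b       = cong (1 ∷_) (merge-ones a b)
  merge-ones zero    zero    = refl
  merge-ones zero    (suc b) = cong (1 ∷_) (merge-ones zero b)
  merge-xs′ : map merge xs′ ≡ xs
  merge-xs′ = trans (map-++ merge ones′ (map suc zs))
    (trans (cong₂ _++_ (merge-ones a b) (merge-suc (All.map <⇒≤ zs≥2))) (sym xs≡))
  merge-ys′ : map merge ys′ ≡ ys
  merge-ys′ = merge-suc (All.map <⇒≤ ys≥2)
  occ-xs′ : ∀ v → occ v xs′ ≡ occ v (replicate a 1) + occ v (replicate b 2) + occ v (map suc zs)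
  occ-xs′ v = trans (occ-++ v ones′ _) (cong (_+ occ v (map suc zs)) (occ-++ v (replicate a 1) _))
  -- Except for 1 and 2, multiplicities are read off through `merge`; these two letters it cannot
  -- tell apart, and they are counted directly below.
  transfer : ∀ {v w} → (∀ us → occ w (map merge us) ≡ occ v us) → occ v xs′ + occ v ys′ ≡ occ w xs + occ w ys
  transfer {v} {w} h = cong₂ _+_
    (trans (sym (h xs′)) (cong (occ w) merge-xs′)) (trans (sym (h ys′)) (cong (occ w) merge-ys′))
  occs′ : ∀ p → occ p xs′ + occ p ys′ ≡ entry (a ∷ b ∷ α) p
  occs′ 0 = trans (transfer occ-merge-0) (occs 0)
  occs′ 1 rewrite occ-xs′ 1 | occ-replicate a 1 | occ-replicate-≢ b {1} {2} (λ ())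
                | occ-none {1} (All.map (λ { (s≤s ()) refl }) zs′≥3)
                | occ-none {1} (All.map (λ { (s≤s ()) refl }) ys′≥3)
                | +-identityʳ a | +-identityʳ a | +-identityʳ a = refl
  occs′ 2 rewrite occ-xs′ 2 | occ-replicate b 2 | occ-replicate-≢ a {2} {1} (λ ())
                | occ-none (≢-from-≥ zs′≥3) | occ-none (≢-from-≥ ys′≥3)
                | +-identityʳ b | +-identityʳ b = refl
  occs′ (suc (suc (suc p))) = trans (transfer (occ-merge-2+ p)) (occs (2 + p))

-- On letters at least 2 `merge` is the predecessor, so the second row is recovered; the content
-- then fixes the multiset of the first row, and sortedness its order.
merge-injective : ∀ {r₁ r₂ α t t′} → Tab r₁ r₂ α t → Tab r₁ r₂ α t′ → High t → High t′ →
                  map (map merge) t ≡ map (map merge) t′ → t ≡ t′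
merge-injective (tab {xs} {ys} _ _ sx _ _ occs) (tab {xs′} {ys′} _ _ sx′ _ _ occs′) (high h) (high h′) eq =
  cong₂ (λ us vs → us ∷ vs ∷ []) (sorted-unique sx sx′ λ v →
    +-cancelʳ-≡ (occ v ys) (occ v xs) (occ v xs′) (trans (occs v) (trans (sym (occs′ v))
      (cong (λ us → occ v xs′ + occ v us) (sym ys≡ys′))))) ys≡ys′
  where
  ys≡ys′ : ys ≡ ys′
  ys≡ys′ = trans (sym (suc-merge (All.map <⇒≤ h)))
    (trans (cong (map suc) (∷-injectiveˡ (∷-injectiveʳ eq))) (suc-merge (All.map <⇒≤ h′)))

-- Tableaux without 2 in the second row correspond to tableaux in which the
-- first two letters are merged; the others are counted by ys.
schur-split : ∀ {r₁ r₂} a b α → r₂ ≤ r₁ → {B : Set} {P : B → Set} {ys : List B} →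
  Enumerates P ys → (R : List (List ℕ) → B → Set) →
  (∀ {t} → Tab r₁ r₂ (a ∷ b ∷ α) t → Low t → ∃ λ y → P y × R t y) →
  (∀ {y} → P y → ∃ λ t → Tab r₁ r₂ (a ∷ b ∷ α) t × R t y) →
  (∀ {t y} → R t y → Low t) →
  (∀ {t t′ y} → R t y → R t′ y → t ≡ t′) →
  (∀ {t y y′} → R t y → R t y′ → y ≡ y′) →
  schur (r₁ ∷ r₂ ∷ []) (a ∷ b ∷ α) ≡ schur (r₁ ∷ r₂ ∷ []) (a + b ∷ α) + length ys
schur-split {r₁} {r₂} a b α r₂≤r₁ {B} {P} {ys} ey R total₂ surj₂ isLow inj₂′ fun₂ = trans
  (length-≡ R′ (enum-schur (a ∷ b ∷ α) r₂≤r₁) (enum-⊎ (enum-schur (a + b ∷ α) r₂≤r₁) ey) total surj inj fun)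
  (length-⊎ (filterᵇ (λ t → colStrict t ∧ hasContent (a + b ∷ α) (concat t))
                     (rowFillings (r₁ ∷ r₂ ∷ []) (range1 (length (a + b ∷ α))))) ys)
  where
  Tab′ = Tab r₁ r₂ (a + b ∷ α)
  R′ : List (List ℕ) → List (List ℕ) ⊎ B → Set
  R′ t (inj₁ t′) = t′ ≡ map (map merge) t × High t
  R′ t (inj₂ y)  = R t y
  total : ∀ {t} → Tab r₁ r₂ (a ∷ b ∷ α) t → ∃ λ z → (Tab′ ⊎ᵖ P) z × R′ t z
  total τ with low⊎high τ
  ... | inj₁ l with y , Py , r ← total₂ τ l = inj₂ y , inʳ Py , r
  ... | inj₂ h = inj₁ _ , inˡ (merge-Tab τ h) , refl , h
  surj : ∀ {z} → (Tab′ ⊎ᵖ P) z → ∃ λ t → Tab r₁ r₂ (a ∷ b ∷ α) t × R′ t z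
  surj (inˡ τ) with t , τ′ , h , eq ← unmerge-Tab a b α τ = t , τ′ , eq , h
  surj (inʳ Py) = surj₂ Py
  inj : ∀ {t t′ z} → Tab r₁ r₂ (a ∷ b ∷ α) t → Tab r₁ r₂ (a ∷ b ∷ α) t′ → (Tab′ ⊎ᵖ P) z →
        R′ t z → R′ t′ z → t ≡ t′
  inj τ τ′ (inˡ _) (eq , h) (eq′ , h′) = merge-injective τ τ′ h h′ (trans (sym eq) eq′)
  inj _ _  (inʳ _) r        r′         = inj₂′ r r′
  fun : ∀ {t z z′} → Tab r₁ r₂ (a ∷ b ∷ α) t → (Tab′ ⊎ᵖ P) z → (Tab′ ⊎ᵖ P) z′ →
        R′ t z → R′ t z′ → z ≡ z′
  fun _ (inˡ _) (inˡ _) (eq , _) (eq′ , _) = cong inj₁ (trans eq (sym eq′))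
  fun _ (inˡ _) (inʳ _) (_ , h)  r         = contradiction h (low-high (isLow r))
  fun _ (inʳ _) (inˡ _) r        (_ , h)   = contradiction h (low-high (isLow r))
  fun _ (inʳ _) (inʳ _) r        r′        = cong inj₂ (fun₂ r r′)

-- Serves the three cases where the column (1, 2) cannot occur: an empty second row, no letter 1, no
-- letter 2.
schur-noLow : ∀ {r₁ r₂} a b α → r₂ ≤ r₁ → (∀ {t} → Tab r₁ r₂ (a ∷ b ∷ α) t → ¬ Low t) →
              schur (r₁ ∷ r₂ ∷ []) (a ∷ b ∷ α) ≡ schur (r₁ ∷ r₂ ∷ []) (a + b ∷ α)
schur-noLow {r₁} {r₂} a b α r₂≤r₁ ¬low = trans
  (schur-split a b α r₂≤r₁ (enum-[] {⊥} {λ _ → ⊥} id) (λ _ _ → ⊥) (λ τ l → ⊥-elim (¬low τ l)) (λ ()) (λ ()) (λ ()) (λ ()))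
  (+-identityʳ _)

schur-row : ∀ r a b α → schur (r ∷ 0 ∷ []) (a ∷ b ∷ α) ≡ schur (r ∷ 0 ∷ []) (a + b ∷ α)
schur-row r a b α = schur-noLow {r} a b α z≤n λ { (tab _ () _ _ _ _) low }

schur-zeroˡ : ∀ {r₁ r₂} b α → r₂ ≤ r₁ → schur (r₁ ∷ r₂ ∷ []) (0 ∷ b ∷ α) ≡ schur (r₁ ∷ r₂ ∷ []) (b ∷ α)
schur-zeroˡ b α r₂≤r₁ = schur-noLow 0 b α r₂≤r₁ λ { (tab _ _ _ _ _ occs) low → contradiction (occs 1) λ () }

schur-zeroʳ : ∀ {r₁ r₂} a α → r₂ ≤ r₁ →
              schur (r₁ ∷ r₂ ∷ []) (a ∷ 0 ∷ α) ≡ schur (r₁ ∷ r₂ ∷ []) (a + 0 ∷ α)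
schur-zeroʳ a α r₂≤r₁ = schur-noLow a 0 α r₂≤r₁
  λ { (tab {_ ∷ xs} _ _ _ _ _ occs) low → contradiction (m+n≡0⇒n≡0 (occ 2 xs) (occs 2)) λ () }

-- A tableau with a 2 in the second row has first column (1, 2), which is removed.
schur-rec : ∀ {r₁ r₂} a b α → r₂ ≤ r₁ →
            schur (suc r₁ ∷ suc r₂ ∷ []) (suc a ∷ suc b ∷ α) ≡
            schur (suc r₁ ∷ suc r₂ ∷ []) (suc a + suc b ∷ α) + schur (r₁ ∷ r₂ ∷ []) (a ∷ b ∷ α)
schur-rec {r₁} {r₂} a b α r₂≤r₁ =
  schur-split (suc a) (suc b) α (s≤s r₂≤r₁) (enum-schur (a ∷ b ∷ α) r₂≤r₁) R
    total surj (λ { column → low }) (λ { column column → refl }) (λ { column column → refl })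
  where
  data R : List (List ℕ) → List (List ℕ) → Set where
    column : ∀ {xs ys} → R ((1 ∷ xs) ∷ (2 ∷ ys) ∷ []) (xs ∷ ys ∷ [])
  total : ∀ {t} → Tab (suc r₁) (suc r₂) (suc a ∷ suc b ∷ α) t → Low t →
          ∃ λ t′ → Tab r₁ r₂ (a ∷ b ∷ α) t′ × R t t′
  total (tab {_ ∷ xs} {_ ∷ ys} lx ly (_ ∷ sx) (_ ∷ sy) (_ ∷ c) occs) low =
    _ , tab (suc-injective lx) (suc-injective ly) sx sy c occs′ , column
    where
    occs′ : ∀ p → occ p xs + occ p ys ≡ entry (a ∷ b ∷ α) p
    occs′ 0 = occs 0
    occs′ 1 = suc-injective (occs 1)
    occs′ 2 = suc-injective (trans (sym (+-suc (occ 2 xs) (occ 2 ys))) (occs 2))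
    occs′ (suc (suc (suc p))) = occs (3 + p)
  surj : ∀ {t′} → Tab r₁ r₂ (a ∷ b ∷ α) t′ →
         ∃ λ t → Tab (suc r₁) (suc r₂) (suc a ∷ suc b ∷ α) t × R t t′
  surj (tab {xs} {ys} lx ly sx sy c occs) = _ ,
    tab (cong suc lx) (cong suc ly) (xs≥1 ∷ sx) (columns-≥ c xs≥1 ∷ sy) (s≤s (s≤s z≤n) ∷ c) occs′ , column
    where
    xs≥1 = positive {a ∷ b ∷ α} {xs} {ys} occs
    occs′ : ∀ p → occ p (1 ∷ xs) + occ p (2 ∷ ys) ≡ entry (suc a ∷ suc b ∷ α) p
    occs′ 0 = occs 0
    occs′ 1 = cong suc (occs 1)
    occs′ 2 = trans (+-suc (occ 2 xs) (occ 2 ys)) (cong suc (occs 2))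
    occs′ (suc (suc (suc p))) = occs (3 + p)

-- Entries of the second row are at least 2, while the content provides only the letter 1.
tab-single : ∀ {r₁ r₂ x t} → Tab r₁ r₂ (x ∷ []) t → r₁ ≡ x × r₂ ≡ 0 × t ≡ canon 1 (x ∷ []) ∷ [] ∷ []
tab-single {x = x} (tab {xs} {[]} refl refl sx _ _ occs)
  with refl ← canon-unique (x ∷ []) sx (λ p → trans (sym (+-identityʳ (occ p xs))) (occs p)) =
  trans (length-canon 1 (x ∷ [])) (+-identityʳ x) , refl , refl
tab-single {x = x} (tab {xs} {y ∷ ys} _ _ _ _ c occs)
  with s≤s (s≤s _) ∷ _ ← columns-≥ c (positive {x ∷ []} {xs} {y ∷ ys} occs) =
  contradiction (m+n≡0⇒n≡0 (occ y xs) (occs y)) (occ-∈ {xs = y ∷ ys} (here refl))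

schur-single-row : ∀ x → schur (x ∷ 0 ∷ []) (x ∷ []) ≡ 1
schur-single-row x = enum-length (enum-schur (x ∷ []) z≤n) enum-[ canon 1 (x ∷ []) ∷ [] ∷ [] ]
  (proj₂ ∘ proj₂ ∘ tab-single)
  (λ { refl → tab (trans (length-canon 1 (x ∷ [])) (+-identityʳ x)) refl (sorted-canon 1 (x ∷ [])) [] []
                  (λ p → trans (+-identityʳ _) (content-canon (x ∷ []) p)) })

schur-single-≢ : ∀ {r₁ r₂ x} → r₂ ≤ r₁ → ¬ (r₁ ≡ x × r₂ ≡ 0) → schur (r₁ ∷ r₂ ∷ []) (x ∷ []) ≡ 0
schur-single-≢ {x = x} r₂≤r₁ ≢ = enum-length (enum-schur (x ∷ []) r₂≤r₁) (enum-[] {P = λ _ → ⊥} id)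
  (λ τ → let e₁ , e₂ , _ = tab-single τ in ≢ (e₁ , e₂)) λ ()

-- The expansion

sum-upTo-suc : ∀ (t : ℕ → ℕ) n → sum (map t (upTo (suc n))) ≡ t 0 + sum (map (t ∘ suc) (upTo n))
sum-upTo-suc t n = cong (λ xs → t 0 + sum xs)
  (trans (map-applyUpTo suc t n) (sym (map-upTo (t ∘ suc) n)))

sum-upTo-cong : ∀ {t u : ℕ → ℕ} n → (∀ {k} → k < n → t k ≡ u k) → sum (map t (upTo n)) ≡ sum (map u (upTo n))
sum-upTo-cong n eq = cong sum (map-cong-local (All.tabulate (eq ∘ ∈-upTo⁻)))

sum-map-+ : ∀ (t u : ℕ → ℕ) xs → sum (map (λ k → t k + u k) xs) ≡ sum (map t xs) + sum (map u xs)
sum-map-+ t u []       = refl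
sum-map-+ t u (x ∷ xs) = begin
  (t x + u x) + sum (map (λ k → t k + u k) xs)        ≡⟨ cong ((t x + u x) +_) (sum-map-+ t u xs) ⟩
  (t x + u x) + (sum (map t xs) + sum (map u xs))     ≡⟨ +-assoc (t x) (u x) _ ⟩
  t x + (u x + (sum (map t xs) + sum (map u xs)))     ≡⟨ cong (t x +_) (+-assoc (u x) _ _) ⟨
  t x + ((u x + sum (map t xs)) + sum (map u xs))     ≡⟨ cong (λ s → t x + (s + sum (map u xs))) (+-comm (u x) _) ⟩
  t x + ((sum (map t xs) + u x) + sum (map u xs))     ≡⟨ cong (t x +_) (+-assoc (sum (map t xs)) _ _) ⟩
  t x + (sum (map t xs) + (u x + sum (map u xs)))     ≡⟨ +-assoc (t x) _ _ ⟨
  (t x + sum (map t xs)) + (u x + sum (map u xs))     ∎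
  where open ≡-Reasoning

sum-map-0 : ∀ {A : Set} {φ : A → ℕ} {xs} → All (λ x → φ x ≡ 0) xs → sum (map φ xs) ≡ 0
sum-map-0 []       = refl
sum-map-0 (e ∷ es) = cong₂ _+_ e (sum-map-0 es)

-- Each element of `ys` is moved to the front of `xs` and split off; the leftovers contribute 0.
-- This cuts the sum over all partitions down to the shapes of the expansion.
sum-support : ∀ {A : Set} {φ : A → ℕ} {xs ys} → Unique xs → Unique ys → (∀ {y} → y ∈ ys → y ∈ xs) →
              (∀ {x} → x ∈ xs → x ∈ ys ⊎ φ x ≡ 0) → sum (map φ xs) ≡ sum (map φ ys)
sum-support {xs = xs} {[]} _ _ _ zero? = sum-map-0 (All.tabulate λ x∈ → vanish (zero? x∈))
  where
  vanish : ∀ {A : Set} {x : A} {n : ℕ} → x ∈ [] ⊎ n ≡ 0 → n ≡ 0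
  vanish (inj₂ e) = e
sum-support {A} {φ} {xs} {y ∷ ys} uxs (y∉ys ∷ uys) sub zero?
  with as , bs , refl ← ∈-∃++ (sub (here refl)) with π ← shift y as bs
  with y∉ ∷ u ← PermSetoid.Unique-resp-↭ (setoid A) (↭⇒↭ₛ π) uxs =
  trans (sum-↭ (Perm.map⁺ φ π)) (cong (φ y +_) (sum-support u uys sub′ zero′))
  where
  sub′ : ∀ {z} → z ∈ ys → z ∈ as ++ bs
  sub′ z∈ with ∈-resp-↭ π (sub (there z∈))
  ... | here refl = contradiction refl (All.lookup y∉ys z∈)
  ... | there z∈′ = z∈′
  zero′ : ∀ {z} → z ∈ as ++ bs → z ∈ ys ⊎ φ z ≡ 0
  zero′ z∈ with zero? (∈-resp-↭ (↭-sym π) (there z∈))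
  ... | inj₁ (here refl) = contradiction refl (All.lookup y∉ z∈)
  ... | inj₁ (there z∈′) = inj₁ z∈′
  ... | inj₂ e           = inj₂ e

double⇒≤∸ : ∀ {k n N} → k ≤ n → 2 * n ≤ N → k ≤ N ∸ k
double⇒≤∸ {k} {n} k≤n 2n≤N = m+n≤o⇒m≤o∸n k
  (≤-trans (+-mono-≤ k≤n (≤-trans k≤n (≤-reflexive (sym (+-identityʳ n))))) 2n≤N)

schurTerm : ℕ → ℕ → List ℕ → ℕ → ℕ
schurTerm N f α k = noShortCount (N ∸ 2 * k) f * schur (N ∸ k ∷ k ∷ []) α

schurTerm-suc : ∀ {N f k} α → k ≤ N →
  schurTerm (2 + N) f α (suc k) ≡ noShortCount (N ∸ 2 * k) f * schur (suc (N ∸ k) ∷ suc k ∷ []) α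
schurTerm-suc {N} {f} {k} α k≤N = cong₂ (λ M r → noShortCount M f * schur (r ∷ suc k ∷ []) α)
  (cong (2 + N ∸_) (*-suc 2 k)) (+-∸-assoc 1 k≤N)

schurSum : ℕ → ℕ → ℕ → Series
schurSum N n f α = sum (map (schurTerm N f α) (upTo (suc n)))

schurSum-cong : ∀ {N} n f α β → 2 * n ≤ N →
  (∀ {r₁ r₂} → r₂ ≤ r₁ → schur (r₁ ∷ r₂ ∷ []) α ≡ schur (r₁ ∷ r₂ ∷ []) β) →
  schurSum N n f α ≡ schurSum N n f β
schurSum-cong {N} n f α β 2n≤N eq = sum-upTo-cong (suc n) λ {k} k< →
  cong (noShortCount (N ∸ 2 * k) f *_) (eq (double⇒≤∸ (s≤s⁻¹ k<) 2n≤N))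

schurSum-row : ∀ N f a b α → schurSum N 0 f (a ∷ b ∷ α) ≡ schurSum N 0 f (a + b ∷ α)
schurSum-row N f a b α = cong (λ s → noShortCount N f * s + 0) (schur-row N a b α)

-- The term `k = 0` has an empty second row and is unchanged by merging. Every later term splits by
-- `schur-rec`, and the parts with a column removed, reindexed by `k - 1`, make up the smaller sum.
schurSum-rec : ∀ {N} n f a b α → 2 * n ≤ N →
  schurSum (2 + N) (suc n) f (suc a ∷ suc b ∷ α) ≡
  schurSum (2 + N) (suc n) f (suc a + suc b ∷ α) + schurSum N n f (a ∷ b ∷ α)
schurSum-rec {N} n f a b α 2n≤N = begin
  schurSum (2 + N) (suc n) f β                                      ≡⟨ sum-upTo-suc tβ (suc n) ⟩
  tβ 0 + sum (map (tβ ∘ suc) (upTo (suc n)))                        ≡⟨ cong₂ _+_ row (trans (sum-upTo-cong (suc n) rec)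
                                                                         (sum-map-+ (tγ ∘ suc) tδ (upTo (suc n)))) ⟩
  tγ 0 + (sum (map (tγ ∘ suc) (upTo (suc n))) + schurSum N n f (a ∷ b ∷ α))  ≡⟨ +-assoc (tγ 0) _ _ ⟨
  tγ 0 + sum (map (tγ ∘ suc) (upTo (suc n))) + schurSum N n f (a ∷ b ∷ α)    ≡⟨ cong (_+ schurSum N n f (a ∷ b ∷ α)) (sum-upTo-suc tγ (suc n)) ⟨
  schurSum (2 + N) (suc n) f γ + schurSum N n f (a ∷ b ∷ α)         ∎
  where
  open ≡-Reasoning
  β γ : List ℕ
  β = suc a ∷ suc b ∷ α
  γ = suc a + suc b ∷ α
  tβ tγ tδ : ℕ → ℕ
  tβ = schurTerm (2 + N) f β
  tγ = schurTerm (2 + N) f γ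
  tδ = schurTerm N f (a ∷ b ∷ α)
  row : tβ 0 ≡ tγ 0
  row = cong (noShortCount (2 + N) f *_) (schur-row (2 + N) (suc a) (suc b) α)
  rec : ∀ {k} → k < suc n → tβ (suc k) ≡ tγ (suc k) + tδ k
  rec {k} k< = begin
    tβ (suc k)                                                      ≡⟨ schurTerm-suc β k≤N ⟩
    u * schur (suc (N ∸ k) ∷ suc k ∷ []) β                          ≡⟨ cong (u *_) (schur-rec a b α k≤N∸k) ⟩
    u * (schur (suc (N ∸ k) ∷ suc k ∷ []) γ + schur (N ∸ k ∷ k ∷ []) (a ∷ b ∷ α))
                                                                    ≡⟨ *-distribˡ-+ u _ _ ⟩
    u * schur (suc (N ∸ k) ∷ suc k ∷ []) γ + tδ k                   ≡⟨ cong (_+ tδ k) (schurTerm-suc γ k≤N) ⟨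
    tγ (suc k) + tδ k                                               ∎
    where
    u     = noShortCount (N ∸ 2 * k) f
    k≤N∸k = double⇒≤∸ (s≤s⁻¹ k<) 2n≤N
    k≤N   = ≤-trans k≤N∸k (m∸n≤m N k)

schurSum-[_] : ∀ {N n} f x → 2 * n ≤ N →
               schurSum N n f (x ∷ []) ≡ (if x ≡ᵇ N then noShortCount N f else 0)
schurSum-[_] {N} {n} f x 2n≤N = trans (sum-upTo-suc (schurTerm N f (x ∷ [])) n)
  (trans (cong₂ _+_ first (sum-map-0 (All.tabulate λ k∈ → others (∈-upTo⁻ k∈)))) (+-identityʳ _))
  where
  first : schurTerm N f (x ∷ []) 0 ≡ (if x ≡ᵇ N then noShortCount N f else 0)
  first with x ≟ N
  ... | yes refl rewrite ≡ᵇ-refl x = trans (cong (noShortCount x f *_) (schur-single-row x)) (*-identityʳ _)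
  ... | no  x≢N  rewrite ≢⇒≡ᵇ x≢N =
    trans (cong (noShortCount N f *_) (schur-single-≢ z≤n (x≢N ∘ sym ∘ proj₁))) (*-zeroʳ (noShortCount N f))
  others : ∀ {k} → k < n → schurTerm N f (x ∷ []) (suc k) ≡ 0
  others {k} k<n = trans (cong (noShortCount (N ∸ 2 * suc k) f *_)
    (schur-single-≢ (double⇒≤∸ k<n 2n≤N) λ { (_ , ()) })) (*-zeroʳ (noShortCount (N ∸ 2 * suc k) f))

-- Solving the common recursion

lhs : ℕ → ℕ → Series
lhs N f α = if sum α ≡ᵇ N then matchingCount N f α else 0

sum-merge : ∀ a b α → sum (suc a + suc b ∷ α) ≡ 2 + (a + (b + sum α))
sum-merge a b α = trans (+-assoc (suc a) (suc b) (sum α)) (cong suc (+-suc a (b + sum α)))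

sum-split : ∀ a b α → sum (suc a ∷ suc b ∷ α) ≡ 2 + (a + (b + sum α))
sum-split a b α = cong suc (+-suc a (b + sum α))

lhs-sum : ∀ N f {s} α → sum α ≡ s → lhs N f α ≡ (if s ≡ᵇ N then matchingCount N f α else 0)
lhs-sum N f α refl = refl

lhs-rec : ∀ N f a b α → lhs (2 + N) f (suc a ∷ suc b ∷ α) ≡
          lhs (2 + N) f (suc a + suc b ∷ α) + lhs N f (a ∷ b ∷ α)
lhs-rec N f a b α = trans (lhs-sum (2 + N) f (suc a ∷ suc b ∷ α) (sum-split a b α))
  (trans (rec (a + (b + sum α)) (m≤m+n a _))
         (cong (_+ lhs N f (a ∷ b ∷ α)) (sym (lhs-sum (2 + N) f (suc a + suc b ∷ α) (sum-merge a b α)))))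
  where
  -- With both larger sums in the form `2 + s`, the three degree tests become the same test on the
  -- size `s` left after the deletion.
  rec : ∀ s → a ≤ s → (if s ≡ᵇ N then matchingCount (2 + N) f (suc a ∷ suc b ∷ α) else 0) ≡
        (if s ≡ᵇ N then matchingCount (2 + N) f (suc a + suc b ∷ α) else 0) +
        (if s ≡ᵇ N then matchingCount N f (a ∷ b ∷ α) else 0)
  rec s a≤s with s ≟ N
  ... | yes refl rewrite ≡ᵇ-refl s = matchingCount-rec f b α a≤s
  ... | no  s≢N  rewrite ≢⇒≡ᵇ s≢N  = refl

lhs-< : ∀ {N f} α → N < f → lhs N f α ≡ 0
lhs-< {N} α N<f with sum α ≡ᵇ N
... | true  = matchingCount-< α N<f
... | false = refl

-- There is no chord to delete: the last term of `lhs-rec` would ask for `f` unmatched vertices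
-- among `f - 2` points. For `f ≤ 1` two nonempty blocks exceed the degree, and both sides are 0.
lhs-row : ∀ f a b α → lhs f f (suc a ∷ suc b ∷ α) ≡ lhs f f (suc a + suc b ∷ α)
lhs-row (suc (suc f)) a b α = trans (lhs-rec f (2 + f) a b α)
  (trans (cong (lhs (2 + f) (2 + f) (suc a + suc b ∷ α) +_) (lhs-< (a ∷ b ∷ α) (n≤1+n (suc f)))) (+-identityʳ _))
lhs-row 0 a b α = trans (lhs-sum 0 0 (suc a ∷ suc b ∷ α) (sum-split a b α))
  (sym (lhs-sum 0 0 (suc a + suc b ∷ α) (sum-merge a b α)))
lhs-row 1 a b α = trans (lhs-sum 1 1 (suc a ∷ suc b ∷ α) (sum-split a b α))
  (sym (lhs-sum 1 1 (suc a + suc b ∷ α) (sum-merge a b α)))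

lhs-zeroˡ : ∀ N f b α → lhs N f (0 ∷ b ∷ α) ≡ lhs N f (b ∷ α)
lhs-zeroˡ N f b α = cong (if sum (b ∷ α) ≡ᵇ N then_else 0) (matchingCount-zeroˡ N f b α)

lhs-zeroʳ : ∀ N f a α → lhs N f (a ∷ 0 ∷ α) ≡ lhs N f (a + 0 ∷ α)
lhs-zeroʳ N f a α = cong₂ (λ s h → if s ≡ᵇ N then h else 0)
  (cong (_+ sum α) (sym (+-identityʳ a))) (matchingCount-zeroʳ N f a α)

lhs-[_] : ∀ N f x → lhs N f (x ∷ []) ≡ (if x ≡ᵇ N then noShortCount N f else 0)
lhs-[_] N f x rewrite +-identityʳ x with x ≟ N
... | yes refl rewrite ≡ᵇ-refl x = matchingCount-[ x ] f
... | no  x≢N  rewrite ≢⇒≡ᵇ x≢N = refl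

module _ (f : ℕ) where

  private
    bound : ∀ n → 2 * n ≤ 2 * n + f
    bound n = m≤m+n (2 * n) f

    Eq : List ℕ → Set
    Eq α = ∀ n → lhs (2 * n + f) f α ≡ schurSum (2 * n + f) n f α

    -- Merging produces an arbitrary first block before the same tail, hence the quantifier in the
    -- hypothesis. The deletion term keeps both blocks and is reached by descending on `a`, `b` and
    -- `n` together.
    two-blocks : ∀ α → (∀ c → Eq (c ∷ α)) → ∀ a b → Eq (a ∷ b ∷ α)
    two-blocks α IH zero b n = trans (lhs-zeroˡ (2 * n + f) f b α) (trans (IH b n)
      (sym (schurSum-cong n f (0 ∷ b ∷ α) (b ∷ α) (bound n) (schur-zeroˡ b α))))
    two-blocks α IH (suc a) zero n = trans (lhs-zeroʳ (2 * n + f) f (suc a) α) (trans (IH (suc a + 0) n)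
      (sym (schurSum-cong n f (suc a ∷ 0 ∷ α) (suc a + 0 ∷ α) (bound n) (schur-zeroʳ (suc a) α))))
    two-blocks α IH (suc a) (suc b) zero = trans (lhs-row f a b α)
      (trans (IH (suc a + suc b) zero) (sym (schurSum-row f f (suc a) (suc b) α)))
    two-blocks α IH (suc a) (suc b) (suc n) = subst
      (λ N → lhs N f (suc a ∷ suc b ∷ α) ≡ schurSum N (suc n) f (suc a ∷ suc b ∷ α)) (sym N≡)
      (begin
        lhs (2 + N) f (suc a ∷ suc b ∷ α)                                 ≡⟨ lhs-rec N f a b α ⟩
        lhs (2 + N) f (suc a + suc b ∷ α) + lhs N f (a ∷ b ∷ α)             ≡⟨ cong₂ _+_ IH′ (two-blocks α IH a b n) ⟩
        schurSum (2 + N) (suc n) f (suc a + suc b ∷ α) + schurSum N n f (a ∷ b ∷ α)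
                                                                        ≡⟨ schurSum-rec n f a b α (bound n) ⟨
        schurSum (2 + N) (suc n) f (suc a ∷ suc b ∷ α)                  ∎)
      where
      open ≡-Reasoning
      N : ℕ
      N = 2 * n + f
      N≡ : 2 * suc n + f ≡ 2 + N
      N≡ = cong (_+ f) (*-suc 2 n)
      IH′ : lhs (2 + N) f (suc a + suc b ∷ α) ≡ schurSum (2 + N) (suc n) f (suc a + suc b ∷ α)
      IH′ = subst (λ M → lhs M f (suc a + suc b ∷ α) ≡ schurSum M (suc n) f (suc a + suc b ∷ α)) N≡
        (IH (suc a + suc b) (suc n))

    nonempty : ∀ α c → Eq (c ∷ α)
    nonempty []      c n = trans (lhs-[ 2 * n + f ] f c) (sym (schurSum-[_] {n = n} f c (bound n)))
    nonempty (b ∷ α) a = two-blocks α (nonempty α) a b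

  lhs≡schurSum : ∀ α → Eq α
  lhs≡schurSum (c ∷ α) n = nonempty α c n
  -- The constant monomial is also given by the exponent list `0 ∷ []`, which reduces this case to a
  -- single block.
  lhs≡schurSum []      n = trans
    (cong (if 0 ≡ᵇ 2 * n + f then_else 0) (matchingCount-cong (2 * n + f) f [] (0 ∷ []) λ { (s≤s _) → refl }))
    (trans (nonempty [] 0 n) (schurSum-cong n f (0 ∷ []) [] (bound n) schur-[]))
    where
    retab : ∀ {r₁ r₂ α β t} → (∀ p → entry α p ≡ entry β p) → Tab r₁ r₂ α t → Tab r₁ r₂ β t
    retab eq (tab lx ly sx sy c occs) = tab lx ly sx sy c λ p → trans (occs p) (eq p)
    entries : ∀ p → entry (0 ∷ []) p ≡ entry [] p
    entries 0             = refl
    entries 1             = refl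
    entries (suc (suc p)) = refl
    schur-[] : ∀ {r₁ r₂} → r₂ ≤ r₁ → schur (r₁ ∷ r₂ ∷ []) (0 ∷ []) ≡ schur (r₁ ∷ r₂ ∷ []) []
    schur-[] r₂≤r₁ = enum-length (enum-schur (0 ∷ []) r₂≤r₁) (enum-schur [] r₂≤r₁)
      (retab entries) (retab (sym ∘ entries))

-- Schur-positivity as a sum over all partitions

unique-partitionsF : ∀ fuel n m → Unique (partitionsF fuel n m)
unique-partitionsF _          zero    _ = [] ∷ []
unique-partitionsF zero       (suc n) _ = []
unique-partitionsF (suc fuel) (suc n) m =
  unique-prepend (λ k → partitionsF fuel (suc n ∸ k) k) (unique-range1 (m ⊓ suc n))
    λ k → unique-partitionsF fuel (suc n ∸ k) k

[]∈partitionsF : ∀ fuel {n} m → n ≡ 0 → [] ∈ partitionsF fuel n m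
[]∈partitionsF _ _ refl = here refl

one-part : ∀ fuel {n m} → 1 ≤ n → n ≤ m → (n ∷ []) ∈ partitionsF (suc fuel) n m
one-part fuel {suc n} {m} 1≤n n≤m = ∈-prepend⁺ (λ k → partitionsF fuel (suc n ∸ k) k)
  (∈-range1⁺ (1≤n , ⊓-glb n≤m ≤-refl)) ([]∈partitionsF fuel (suc n) (n∸n≡0 n))

-- Fails for `N = 0`, where `[]` is listed instead of `0 ∷ []`; the theorem supplies the bound
-- through `1 ≤ n`.
single-part : ∀ {N} → 1 ≤ N → (N ∷ []) ∈ partitions N
single-part {suc M} 1≤N = one-part M 1≤N ≤-refl

two-parts : ∀ {N k} → suc k ≤ N ∸ suc k → (N ∸ suc k ∷ suc k ∷ []) ∈ partitions N
two-parts {suc zero}    {k} k≤ with () ← ≤-trans k≤ (≤-reflexive (0∸n≡0 k))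
two-parts {suc (suc M)} {k} k≤ = ∈-prepend⁺ (λ j → partitionsF (suc M) (2 + M ∸ j) j)
  (∈-range1⁺ (≤-trans (s≤s z≤n) k≤ , ⊓-glb N∸k≤N N∸k≤N))
  (subst (λ j → (suc k ∷ []) ∈ partitionsF (suc M) j (2 + M ∸ suc k))
    (sym (m∸[m∸n]≡n (≤-trans k≤ N∸k≤N))) (one-part M (s≤s z≤n) k≤))
  where
  N∸k≤N : 2 + M ∸ suc k ≤ 2 + M
  N∸k≤N = m∸n≤m (2 + M) (suc k)

module _ (N n f : ℕ) (1≤N : 1 ≤ N) (2n≤N : 2 * n ≤ N) where

  private
    open DecMembership (≡-dec _≟_) using (_∈?_)

    shape : ℕ → List ℕ
    shape k = N ∸ suc k ∷ suc k ∷ []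

    shapes : List (List ℕ)
    shapes = (N ∷ []) ∷ map shape (upTo n)

    weight : List ℕ → ℕ
    weight []          = 0
    weight (_ ∷ [])    = noShortCount N f
    weight (_ ∷ k ∷ _) = noShortCount (N ∸ 2 * k) f

    -- A coefficient is due at every partition, and `weight` looks only at the second part; the
    -- cutoff keeps it from charging partitions with three or more parts.
    coefficient : List ℕ → ℕ
    coefficient μ = if does (μ ∈? shapes) then weight μ else 0

    coefficient-∈ : ∀ {μ} → μ ∈ shapes → coefficient μ ≡ weight μ
    coefficient-∈ {μ} μ∈ = cong (if_then weight μ else 0) (dec-true (μ ∈? shapes) μ∈)

    unique-shapes : Unique shapes
    unique-shapes = All.tabulate (λ { μ∈ refl → long μ∈ }) ∷
      Unique.map⁺ (λ eq → suc-injective (∷-injectiveˡ (∷-injectiveʳ eq))) (Unique.upTo⁺ n)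
      where
      long : ¬ (N ∷ []) ∈ map shape (upTo n)
      long μ∈ with _ , _ , () ← ∈-map⁻ shape μ∈

    shapes⊆partitions : ∀ {μ} → μ ∈ shapes → μ ∈ partitions N
    shapes⊆partitions (here refl) = single-part 1≤N
    shapes⊆partitions (there μ∈) with k , k∈ , refl ← ∈-map⁻ shape μ∈ = two-parts {N} (double⇒≤∸ (∈-upTo⁻ k∈) 2n≤N)

    summand : List ℕ → List ℕ → ℕ
    summand α μ = coefficient μ * schur μ α

    supported : ∀ α {μ} → μ ∈ partitions N → μ ∈ shapes ⊎ summand α μ ≡ 0
    supported α {μ} _ with μ ∈? shapes
    ... | yes μ∈ = inj₁ μ∈
    ... | no  μ∉ = inj₂ (cong (λ b → (if b then weight μ else 0) * schur μ α) (dec-false (μ ∈? shapes) μ∉))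

    sum-shapes : ∀ α → sum (map (summand α) shapes) ≡ schurSum N n f α
    sum-shapes α = begin
      summand α (N ∷ []) + sum (map (summand α) (map shape (upTo n)))
        ≡⟨ cong₂ _+_ (cong₂ _*_ (coefficient-∈ (here refl)) (schur-[ N ] α))
             (cong sum (trans (sym (map-∘ (upTo n))) (map-cong-local (All.tabulate λ {k} k∈ →
               cong (_* schur (shape k) α) (coefficient-∈ (there (∈-map⁺ shape k∈))))))) ⟩
      schurTerm N f α 0 + sum (map (schurTerm N f α ∘ suc) (upTo n))
        ≡⟨ sum-upTo-suc (schurTerm N f α) n ⟨
      schurSum N n f α ∎
      where
      open ≡-Reasoning

  schurSum-positive : SchurPositive N (schurSum N n f)
  schurSum-positive = coefficient , λ α → sym (trans
    (sum-support (unique-partitionsF N N N) unique-shapes shapes⊆partitions (supported α))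
    (sum-shapes α))

theorem1p6 : (n f : ℕ) → 1 ≤ n →
    SchurPositive (2 * n + f) (Q (2 * n + f) Short (matchingsF (2 * n + f) f))
    × (Q (2 * n + f) Short (matchingsF (2 * n + f) f) ≈ rhs n f)
theorem1p6 n f 1≤n = (proj₁ positive-rhs , λ α → trans (expansion α) (proj₂ positive-rhs α)) , expansion
  where
  expansion : Q (2 * n + f) Short (matchingsF (2 * n + f) f) ≈ rhs n f
  expansion α = trans (Q-eval (2 * n + f) f α) (lhs≡schurSum f α n)
  positive-rhs : SchurPositive (2 * n + f) (rhs n f)
  positive-rhs = schurSum-positive (2 * n + f) n f
    (≤-trans 1≤n (≤-trans (m≤m+n n (n + 0)) (m≤m+n (2 * n) f))) (m≤m+n (2 * n) f)
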